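{- Trees on $n$ vertices with distinct chromatic symmetric functions form an antichain in $\mathcal{S}_n$; that is, if $T_1$ and $T_2$ are trees on $n$ vertices with $X_{T_1}\neq X_{T_2}$, then neither $T_1\geq_s T_2$ nor $T_2\geq_s T_1$.
   Context: All graphs are finite and simple. The chromatic symmetric function of a graph $G$ with vertices $v_1,\dots,v_n$ is $X_G=\sum_{\kappa}x_{\kappa(v_1)}\cdots x_{\kappa(v_n)}$, summed over all proper colorings $\kappa:V(G)\to\{1,2,3,\dots\}$; it is a homogeneous symmetric function of degree $n$ over $\mathbb{Q}$. Let $s_\lambda$ be the Schur symmetric functions; $[s_\lambda]F$ denotes the coefficient of $s_\lambda$ in $F$ expanded in this basis, and $F$ is Schur-positive if $[s_\lambda]F\ge 0$ for all $\lambda$. For connected graphs $G,H$ on $n$ vertices (for which $[s_{(1^n)}]X_G$ and $[s_{(1^n)}]X_H$ are positive), set $$X_s(G,H)=X_G-\frac{[s_{(1^n)}]X_G}{[s_{(1^n)}]X_H}X_H.$$ $\mathcal{S}_n$ is the poset whose elements are the equivalence classes of connected graphs on $n$ vertices under $G\sim H\iff X_G=X_H$, ordered by $G\geq_s H$ if and only if $X_s(G,H)$ is Schur-positive. -}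

module Defs where

open import Data.Fin.Base as Fin using (Fin)
import Data.Fin.Properties as Fin
open import Data.Integer.Base using (+_)
open import Data.List.Base
  using (List; []; _∷_; _∷ʳ_; allFin; cartesianProductWith; concat; concatMap;
         filter; foldr; length; lookup; map; replicate; take)
open import Data.List.Relation.Binary.Pointwise as Pointwise using (Pointwise)
open import Data.List.Relation.Unary.All using (All; all?)
open import Data.List.Relation.Unary.Linked using (Linked; linked?)
open import Data.List.Relation.Unary.Unique.Propositional using (Unique)
open import Data.Nat.Base using (ℕ; zero; suc) renaming (_≤_ to _≤ⁿ_)
import Data.Nat.Properties as ℕ
open import Data.Product.Base using (_×_; Σ-syntax)
open import Data.Rational.Base
  using (ℚ; 0ℚ; _+_; _-_; _*_; _÷_; _/_; _≤_; NonZero)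
open import Data.Vec.Base as Vec using (Vec)
open import Level using (0ℓ)
open import Relation.Binary.Construct.Closure.ReflexiveTransitive using (Star)
open import Relation.Binary.Core using (Rel)
open import Relation.Binary.Definitions using (Decidable; Irreflexive; Symmetric)
open import Relation.Binary.PropositionalEquality using (_≡_; _≢_)
open import Relation.Nullary using (Dec; ¬_; ¬?; _×-dec_; _→-dec_)

------------------------------------------------------------------------
-- Graphs

record Graph (n : ℕ) : Set₁ where
  infix 4 _∼_ _∼?_
  field
    _∼_      : Rel (Fin n) 0ℓ
    _∼?_     : Decidable _∼_
    ∼-sym    : Symmetric _∼_
    ∼-irrefl : Irreflexive _≡_ _∼_

module _ {n : ℕ} (G : Graph n) where
  open Graph G

  Connected : Set
  Connected = ∀ u v → Star _∼_ u v

  -- A cycle v, v₁, …, vₘ, v has at least three distinct vertices, so m ≥ 2.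
  IsCycle : Fin n → List (Fin n) → Set
  IsCycle v vs = 2 ≤ⁿ length vs × Unique (v ∷ vs) × Linked _∼_ (v ∷ (vs ∷ʳ v))

  Acyclic : Set
  Acyclic = ∀ v vs → ¬ IsCycle v vs

  IsTree : Set
  IsTree = Connected × Acyclic

  ProperColoring : ∀ {k} → Vec (Fin k) n → Set
  ProperColoring κ = ∀ u v → u ∼ v → Vec.lookup κ u ≢ Vec.lookup κ v

  properColoring? : ∀ {k} (κ : Vec (Fin k) n) → Dec (ProperColoring κ)
  properColoring? κ = Fin.all? λ u → Fin.all? λ v →
    (u ∼? v) →-dec ¬? (Vec.lookup κ u Fin.≟ Vec.lookup κ v)

------------------------------------------------------------------------
-- Formal power series over ℚ in x₁, x₂, x₃, …
--
-- The list α₁ ∷ … ∷ αₖ ∷ [] stands for the monomial x₁^α₁ ⋯ xₖ^αₖ, and a series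
-- is given by its coefficients.  Lists that differ by trailing zeros stand for
-- the same monomial; X and s below take the same value on them.

Series : Set
Series = List ℕ → ℚ

infix 4 _≈_
_≈_ : Rel Series 0ℓ
F ≈ H = ∀ α → F α ≡ H α

infixl 6 _⊖_
_⊖_ : Series → Series → Series
(F ⊖ H) α = F α - H α

infixr 7 _·_
_·_ : ℚ → Series → Series
(q · F) α = q * F α

∑ : ∀ {a} {A : Set a} → List A → (A → Series) → Series
∑ xs F α = foldr _+_ 0ℚ (map (λ x → F x α) xs)

∣_∣ˢ : ∀ {a} {A : Set a} → List A → ℚ
∣ xs ∣ˢ = (+ length xs) / 1

-- w represents the monomial α: the i-th letter occurs αᵢ times in w, and no
-- letter beyond the length of α occurs.
HasContent : (α : List ℕ) → List (Fin (length α)) → Set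
HasContent α w = ∀ i → length (filter (i Fin.≟_) w) ≡ lookup α i

hasContent? : ∀ α w → Dec (HasContent α w)
hasContent? α w = Fin.all? λ i → length (filter (i Fin.≟_) w) ℕ.≟ lookup α i

words : (k m : ℕ) → List (Vec (Fin k) m)
words k zero    = Vec.[] ∷ []
words k (suc m) = cartesianProductWith Vec._∷_ (allFin k) (words k m)

-- The coefficient of x₁^α₁ ⋯ xₖ^αₖ in X_G is the number of proper colorings
-- using the color i exactly αᵢ times; these only use the colors 1, …, k.
X : ∀ {n} → Graph n → Series
X {n} G α = ∣ filter (λ κ → properColoring? G κ ×-dec hasContent? α (Vec.toList κ))
                     (words (length α) n) ∣ˢ

------------------------------------------------------------------------
-- Partitions

grow : List ℕ → List (List ℕ)
grow []       = (1 ∷ []) ∷ []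
grow (a ∷ as) = (1 ∷ a ∷ as) ∷ (suc a ∷ as) ∷ []

-- A composition of n + 1 either begins with 1 or has first part at least 2;
-- removing that 1, or lowering that part by 1, leaves a composition of n.
compositions : ℕ → List (List ℕ)
compositions zero    = [] ∷ []
compositions (suc n) = concatMap grow (compositions n)

partitions : ℕ → List (List ℕ)
partitions n = filter (linked? ℕ._≥?_) (compositions n)

------------------------------------------------------------------------
-- Schur functions, as generating functions of semistandard Young tableaux

-- A tableau is the list of its rows, from top to bottom (English notation).
Tableau : ℕ → Set
Tableau k = List (List (Fin k))

fillings : (k : ℕ) → List ℕ → List (Tableau k)
fillings k []       = [] ∷ []
fillings k (l ∷ ls) =
  cartesianProductWith _∷_ (map Vec.toList (words k l)) (fillings k ls)

module _ {k : ℕ} where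

  -- The second row is no longer than the first, and each of its entries is
  -- larger than the entry directly above it.
  _Above_ : Rel (List (Fin k)) 0ℓ
  r Above r′ = Pointwise Fin._<_ (take (length r′) r) r′

  Semistandard : Tableau k → Set
  Semistandard T = All (Linked Fin._≤_) T × Linked _Above_ T

  semistandard? : (T : Tableau k) → Dec (Semistandard T)
  semistandard? T =
    all? (linked? Fin._≤?_) T
      ×-dec linked? (λ r r′ → Pointwise.decidable Fin._<?_ (take (length r′) r) r′) T

s : List ℕ → Series
s λs α = ∣ filter (λ T → semistandard? T ×-dec hasContent? α (concat T))
                  (fillings (length α) λs) ∣ˢ

-- Expansion in the Schur basis of a symmetric function F homogeneous of degree
-- n: only partitions of n contribute.  The values of coeff at partitions of n
-- are determined by F; its other values are irrelevant.
record SchurExpansion (n : ℕ) (F : Series) : Set where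
  field
    coeff   : List ℕ → ℚ
    expands : F ≈ ∑ (partitions n) (λ λs → coeff λs · s λs)

infix 8 [s_]_
[s_]_ : ∀ {n F} → List ℕ → SchurExpansion n F → ℚ
[s λs ] E = SchurExpansion.coeff E λs

SchurPositive : ℕ → Series → Set
SchurPositive n F =
  Σ[ E ∈ SchurExpansion n F ] All (λ λs → 0ℚ ≤ [s λs ] E) (partitions n)

------------------------------------------------------------------------
-- The poset of connected graphs on n vertices

-- Elements are represented by connected graphs; equality of the elements
-- represented by G and H is X (graph G) ≈ X (graph H).
record 𝒮 (n : ℕ) : Set₁ where
  field
    graph     : Graph n
    connected : Connected graph

open 𝒮 public

module _ {n : ℕ} (G H : 𝒮 n) where

  Xₛ : (E : SchurExpansion n (X (graph G))) (E′ : SchurExpansion n (X (graph H))) →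
       .{{NonZero ([s replicate n 1 ] E′)}} → Series
  Xₛ E E′ = X (graph G) ⊖ ([s replicate n 1 ] E ÷ [s replicate n 1 ] E′) · X (graph H)

  -- The Schur expansions of X_G and X_H exist and are unique, and the
  -- coefficient in the denominator is positive, so quantifying over them
  -- existentially only names them.
  infix 4 _≥ₛ_
  _≥ₛ_ : Set
  _≥ₛ_ = Σ[ E ∈ SchurExpansion n (X (graph G)) ]
         Σ[ E′ ∈ SchurExpansion n (X (graph H)) ]
         Σ[ nz ∈ NonZero ([s replicate n 1 ] E′) ]
         SchurPositive n (Xₛ E E′ {{nz}})

{-# OPTIONS --safe #-}

-- The alternating sum over k of the sums of the coefficients of F at the
-- compositions of n with k parts is a linear functional which vanishes on s_λ
-- unless λ = 1ⁿ: a tableau using exactly the letters 1, …, k has its letter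
-- T₁₂ split into two letters, or merged with the preceding letter, and this is
-- an involution changing k by one.  On X_G the functional only depends on the
-- numbers of surjective proper colorings, which are the same for all trees on
-- n vertices, so [s_{1ⁿ}] X_G is the same for all trees.
--
-- Hence T₁ ≥ₛ T₂ makes X_{T₁} − X_{T₂} Schur-positive, and so a series with
-- nonnegative coefficients.  Their sum over all monomials in k variables is the
-- difference of the numbers of proper k-colorings of T₁ and T₂, which is zero;
-- so all coefficients vanish.
module Submission where

open import Algebra.Bundles using (CommutativeMonoid)
import Algebra.Properties.AbelianGroup as AbelianGroupProperties
import Algebra.Properties.CommutativeSemigroup as CommutativeSemigroupProperties
open import Data.Bool.Base using (if_then_else_)
open import Data.Empty using (⊥)
open import Data.Fin.Base as Fin using (Fin; zero; suc; inject₁; pinch; punchIn; punchOut)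
import Data.Fin.Properties as Fin
import Data.Integer.Base as ℤ
import Data.Integer.Properties as ℤ
open import Data.List.Base
  using (List; []; _∷_; _++_; _∷ʳ_; allFin; cartesianProductWith; concat; drop; filter;
         foldr; length; lookup; map; replicate; upTo)
import Data.List.Membership.DecPropositional as DecMembership
open import Data.List.Membership.Propositional using (_∈_; _∉_; find; lose)
open import Data.List.Membership.Propositional.Properties
import Data.List.Properties as List
open import Data.List.Relation.Binary.Pointwise using (Pointwise; []; _∷_)
open import Data.List.Relation.Unary.All as All using (All; []; _∷_)
import Data.List.Relation.Unary.All.Properties as All
open import Data.List.Relation.Unary.AllPairs as AllPairs using ([]; _∷_)
import Data.List.Relation.Unary.AllPairs.Properties as AllPairs
open import Data.List.Relation.Unary.Any using (Any; here; there)
open import Data.List.Relation.Unary.Linked as Linked using (Linked; []; [-]; _∷_; linked?)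
import Data.List.Relation.Unary.Linked.Properties as Linked
open import Data.List.Relation.Unary.Unique.Propositional using (Unique)
import Data.List.Relation.Unary.Unique.Propositional.Properties as Unique
open import Data.Nat.Base
  using (ℕ; zero; suc; _+_; _*_; _∸_; _^_; _≤_; _<_; _≥_; z≤n; s≤s)
open import Data.Nat.ListAction using (sum)
import Data.Nat.Properties as ℕ
open import Data.Product.Base using (_×_; _,_; proj₁; proj₂; ∃; ∃₂)
open import Data.Rational.Base as ℚ
  using (ℚ; 0ℚ; 1ℚ; _÷_; _/_; NonZero; Positive; nonNegative; positive; toℚᵘ)
  renaming (_+_ to _+ℚ_; _-_ to _-ℚ_; _*_ to _*ℚ_; _≤_ to _≤ℚ_; _<_ to _<ℚ_)
import Data.Rational.Properties as ℚ
open import Data.Rational.Unnormalised.Base as ℚᵘ using (mkℚᵘ; *≡*)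
import Data.Rational.Unnormalised.Properties as ℚᵘ
open import Data.Sum.Base as Sum using (_⊎_; inj₁; inj₂)
open import Data.Unit.Base using (⊤; tt)
open import Data.Vec.Base as Vec using (Vec)
import Data.Vec.Membership.Propositional.Properties as VecMembership
import Data.Vec.Properties as Vec
open import Function.Base using (_∘_; id)
open import Level using (Level)
open import Relation.Binary.Construct.Closure.ReflexiveTransitive using (Star; ε; _◅_)
open import Relation.Binary.PropositionalEquality
  using (_≡_; _≢_; refl; sym; trans; cong; cong₂; subst; subst₂; module ≡-Reasoning)
open import Relation.Nullary
  using (Dec; yes; no; does; ¬_; ¬?; _×-dec_; _→-dec_; contradiction)
open import Relation.Unary using (Pred; Decidable)
open import Defs

open AbelianGroupProperties ℚ.+-0-abelianGroup using () renaming (∙-cancelˡ to ℚ-+-cancelˡ)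
open CommutativeSemigroupProperties ℕ.+-commutativeSemigroup using (interchange)
open CommutativeSemigroupProperties
  (CommutativeMonoid.commutativeSemigroup ℚ.+-0-commutativeMonoid)
  using () renaming (interchange to ℚ-interchange)

-- Counting in lists

-- If c_k is the sum of the coefficients of a symmetric function F at the compositions with k parts,
-- then F at t variables equal to 1 is the sum of binomial(t,k) c_k, and binomial(-1,k) = (-1)^k.
-- The functional is thus, up to sign, the value at t = -1. By the hook-content formula the cell in
-- row 1, column 2 contributes a factor t + 1 to s_λ; this is why every shape with such a cell dies,
-- and why the involution acts on the letter in that cell. On X_G the value is, up to sign, the
-- chromatic polynomial at -1, hence the number of acyclic orientations.
--
-- Surjective colorings do not survive the removal of a leaf: the remaining vertices may miss a
-- color. The induction over leaves therefore counts proper colorings with an arbitrary weight g(d),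
-- where d is the number of colors used. A new leaf has d - 1 old and k - d new colors to choose
-- from, in whichever tree it is attached. The indicator of d = k serves the functional, the
-- constant 1 the final comparison.

variable
  a b p q : Level
  A : Set a
  B : Set b
  P : Set p
  Q : Set q

∑ℕ : List A → (A → ℕ) → ℕ
∑ℕ xs f = sum (map f xs)

∑ℕ-cong-∈ : (xs : List A) {f g : A → ℕ} → (∀ {x} → x ∈ xs → f x ≡ g x) → ∑ℕ xs f ≡ ∑ℕ xs g
∑ℕ-cong-∈ []       f≗g = refl
∑ℕ-cong-∈ (x ∷ xs) f≗g = cong₂ _+_ (f≗g (here refl)) (∑ℕ-cong-∈ xs (f≗g ∘ there))

∑ℕ-cong : (xs : List A) {f g : A → ℕ} → (∀ x → f x ≡ g x) → ∑ℕ xs f ≡ ∑ℕ xs g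
∑ℕ-cong xs f≗g = ∑ℕ-cong-∈ xs (λ {x} _ → f≗g x)

∑ℕ-zero : (xs : List A) → ∑ℕ xs (λ _ → 0) ≡ 0
∑ℕ-zero []       = refl
∑ℕ-zero (x ∷ xs) = ∑ℕ-zero xs

∑ℕ-+ : (xs : List A) (f g : A → ℕ) → ∑ℕ xs (λ x → f x + g x) ≡ ∑ℕ xs f + ∑ℕ xs g
∑ℕ-+ []       f g = refl
∑ℕ-+ (x ∷ xs) f g rewrite ∑ℕ-+ xs f g = interchange (f x) (g x) (∑ℕ xs f) (∑ℕ xs g)

∑ℕ-*ˡ : (c : ℕ) (xs : List A) (f : A → ℕ) → ∑ℕ xs (λ x → c * f x) ≡ c * ∑ℕ xs f
∑ℕ-*ˡ c []       f = sym (ℕ.*-zeroʳ c)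
∑ℕ-*ˡ c (x ∷ xs) f rewrite ∑ℕ-*ˡ c xs f = sym (ℕ.*-distribˡ-+ c (f x) (∑ℕ xs f))

∑ℕ-swap : (xs : List A) (ys : List B) (f : A → B → ℕ) →
  ∑ℕ xs (λ x → ∑ℕ ys (f x)) ≡ ∑ℕ ys (λ y → ∑ℕ xs (λ x → f x y))
∑ℕ-swap []       ys f = sym (∑ℕ-zero ys)
∑ℕ-swap (x ∷ xs) ys f rewrite ∑ℕ-swap xs ys f =
  sym (∑ℕ-+ ys (f x) (λ y → ∑ℕ xs (λ x → f x y)))

∑ℕ-++ : (xs ys : List A) (f : A → ℕ) → ∑ℕ (xs ++ ys) f ≡ ∑ℕ xs f + ∑ℕ ys f
∑ℕ-++ []       ys f = refl
∑ℕ-++ (x ∷ xs) ys f rewrite ∑ℕ-++ xs ys f = sym (ℕ.+-assoc (f x) (∑ℕ xs f) (∑ℕ ys f))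

∑ℕ-map : (g : A → B) (xs : List A) (f : B → ℕ) → ∑ℕ (map g xs) f ≡ ∑ℕ xs (f ∘ g)
∑ℕ-map g []       f = refl
∑ℕ-map g (x ∷ xs) f = cong (f (g x) +_) (∑ℕ-map g xs f)

∑ℕ-cartesianProductWith : ∀ {c} {C : Set c} (h : A → B → C) xs ys (f : C → ℕ) →
  ∑ℕ (cartesianProductWith h xs ys) f ≡ ∑ℕ xs (λ x → ∑ℕ ys (λ y → f (h x y)))
∑ℕ-cartesianProductWith h []       ys f = refl
∑ℕ-cartesianProductWith h (x ∷ xs) ys f = begin
  ∑ℕ (map (h x) ys ++ cartesianProductWith h xs ys) f
    ≡⟨ ∑ℕ-++ (map (h x) ys) _ f ⟩
  ∑ℕ (map (h x) ys) f + ∑ℕ (cartesianProductWith h xs ys) f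
    ≡⟨ cong₂ _+_ (∑ℕ-map (h x) ys f) (∑ℕ-cartesianProductWith h xs ys f) ⟩
  ∑ℕ ys (f ∘ h x) + ∑ℕ xs (λ x → ∑ℕ ys (λ y → f (h x y))) ∎
  where open ≡-Reasoning

𝟙 : Dec P → ℕ
𝟙 d = if does d then 1 else 0

𝟙-yes : (d : Dec P) → P → 𝟙 d ≡ 1
𝟙-yes (yes _) _ = refl
𝟙-yes (no ¬p) p = contradiction p ¬p

𝟙-no : (d : Dec P) → ¬ P → 𝟙 d ≡ 0
𝟙-no (yes p) ¬p = contradiction p ¬p
𝟙-no (no _)  _  = refl

𝟙-cong : (d : Dec P) (e : Dec Q) → (P → Q) → (Q → P) → 𝟙 d ≡ 𝟙 e
𝟙-cong (yes p) e f g = sym (𝟙-yes e (f p))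
𝟙-cong (no ¬p) e f g = sym (𝟙-no e (¬p ∘ g))

𝟙-× : (d : Dec P) (e : Dec Q) → 𝟙 (d ×-dec e) ≡ 𝟙 d * 𝟙 e
𝟙-× (yes _) (yes _) = refl
𝟙-× (yes _) (no _)  = refl
𝟙-× (no _)  (yes _) = refl
𝟙-× (no _)  (no _)  = refl

length-filter-∑ : {P : Pred A p} (P? : Decidable P) (xs : List A) →
  length (filter P? xs) ≡ ∑ℕ xs (𝟙 ∘ P?)
length-filter-∑ P? []       = refl
length-filter-∑ P? (x ∷ xs) with P? x
... | yes _ = cong suc (length-filter-∑ P? xs)
... | no _  = length-filter-∑ P? xs

-- The pigeonhole principle: cancel the first entry of `xs` against one of its occurrences in `ys`;
-- uniqueness keeps the other entries in what remains.
unique-⊆-length : {xs : List A} (ys : List A) → Unique xs → (∀ {x} → x ∈ xs → x ∈ ys) →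
  length xs ≤ length ys
unique-⊆-length {xs = []}     ys u        xs⊆ys = z≤n
unique-⊆-length {xs = x ∷ xs} ys (x≢ ∷ u) xs⊆ys with ∈-∃++ (xs⊆ys (here refl))
... | as , bs , refl = begin
  suc (length xs)              ≤⟨ s≤s (unique-⊆-length (as ++ bs) u sub) ⟩
  suc (length (as ++ bs))      ≡⟨ cong suc (List.length-++ as) ⟩
  suc (length as + length bs)  ≡⟨ ℕ.+-suc (length as) (length bs) ⟨
  length as + suc (length bs)  ≡⟨ List.length-++ as ⟨
  length (as ++ x ∷ bs)        ∎
  where
  open ℕ.≤-Reasoning
  sub : ∀ {y} → y ∈ xs → y ∈ as ++ bs
  sub y∈xs with ∈-++⁻ as (xs⊆ys (there y∈xs))
  ... | inj₁ y∈as         = ∈-++⁺ˡ y∈as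
  ... | inj₂ (here refl)  = contradiction refl (All.lookup x≢ y∈xs)
  ... | inj₂ (there y∈bs) = ∈-++⁺ʳ as y∈bs

-- The images under `g` of the entries of `ys` cover `xs`, whatever `g` does off the image of `f`.
-- Used in both directions, this compares two lists by maps that are junk elsewhere.
retract⇒length-≤ : {xs : List A} {ys : List B} → Unique xs → (f : A → B) (g : B → A) →
  (∀ {x} → x ∈ xs → f x ∈ ys) → (∀ {x} → x ∈ xs → g (f x) ≡ x) → length xs ≤ length ys
retract⇒length-≤ {xs = xs} {ys} u f g f∈ gf = begin
  length xs          ≤⟨ unique-⊆-length (map g ys) u
                         (λ x∈ → subst (_∈ map g ys) (gf x∈) (∈-map⁺ g (f∈ x∈))) ⟩
  length (map g ys)  ≡⟨ List.length-map g ys ⟩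
  length ys          ∎
  where open ℕ.≤-Reasoning

∑ℕ-𝟙-unique : {xs : List A} {P : Pred A p} (P? : Decidable P) → Unique xs → ∀ {a} →
  a ∈ xs → P a → (∀ {b} → P b → b ≡ a) → ∑ℕ xs (𝟙 ∘ P?) ≡ 1
∑ℕ-𝟙-unique {xs = xs} P? u {a} a∈xs Pa only = trans (sym (length-filter-∑ P? xs)) (ℕ.≤-antisym
  (unique-⊆-length (a ∷ []) (Unique.filter⁺ P? u) λ x∈ → here (only (proj₂ (∈-filter⁻ P? {xs = xs} x∈))))
  (unique-⊆-length _ ([] ∷ []) λ { (here refl) → ∈-filter⁺ P? a∈xs Pa }))

∑ℕ-𝟙-none : (xs : List A) {P : Pred A p} (P? : Decidable P) →
  (∀ {x} → x ∈ xs → ¬ P x) → ∑ℕ xs (𝟙 ∘ P?) ≡ 0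
∑ℕ-𝟙-none xs P? none = trans (∑ℕ-cong-∈ xs (λ {x} x∈ → 𝟙-no (P? x) (none x∈))) (∑ℕ-zero xs)

-- Sums over boxes of exponent vectors

box : List ℕ → (k : ℕ) → List (Vec ℕ k)
box ps zero    = Vec.[] ∷ []
box ps (suc k) = cartesianProductWith Vec._∷_ ps (box ps k)

box-unique : ∀ {ps} → Unique ps → ∀ k → Unique (box ps k)
box-unique u zero    = [] ∷ []
box-unique u (suc k) = Unique.cartesianProductWith⁺ Vec._∷_ Vec.∷-injective u (box-unique u k)

∈-box⁺ : ∀ {ps} k (f : Fin k → ℕ) → (∀ i → f i ∈ ps) → Vec.tabulate f ∈ box ps k
∈-box⁺ zero    f f∈ = here refl
∈-box⁺ (suc k) f f∈ = ∈-cartesianProductWith⁺ Vec._∷_ (f∈ zero) (∈-box⁺ k (f ∘ suc) (f∈ ∘ suc))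

∈-box⁻ : ∀ {ps} k {v : Vec ℕ k} → v ∈ box ps k → ∀ i → Vec.lookup v i ∈ ps
∈-box⁻ {ps} (suc k) v∈ i with ∈-cartesianProductWith⁻ Vec._∷_ ps (box ps k) v∈
∈-box⁻ {ps} (suc k) v∈ zero    | _ , _ , c∈ , w∈ , refl = c∈
∈-box⁻ {ps} (suc k) v∈ (suc i) | _ , _ , c∈ , w∈ , refl = ∈-box⁻ k w∈ i

occ : ∀ {k} → List (Fin k) → Fin k → ℕ
occ w i = length (filter (i Fin.≟_) w)

open DecMembership ℕ._≟_ using () renaming (_∈?_ to _∈ℕ?_)

module _ {k : ℕ} {A : Set a} {P : Pred A p} (P? : Decidable P) (word : A → List (Fin k)) where

  withOcc : List A → (Fin k → ℕ) → ℕ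
  withOcc xs f = length (filter (λ x → P? x ×-dec Fin.all? λ i → occ (word x) i ℕ.≟ f i) xs)

  withOcc-cong : ∀ xs {f g} → (∀ i → f i ≡ g i) → withOcc xs f ≡ withOcc xs g
  withOcc-cong xs f≗g = cong length (List.filter-≐ _ _
    ((λ (px , h) → px , λ i → trans (h i) (f≗g i)) , (λ (px , h) → px , λ i → trans (h i) (sym (f≗g i)))) xs)

  -- Double counting: the occurrence numbers of `word x` form exactly one exponent vector, and it
  -- lies in the box precisely when all of them lie in `ps`. Positive exponents will single out the
  -- words that use every letter; a long initial interval will impose no condition.
  ∑-box-withOcc : ∀ {ps} → Unique ps → ∀ xs →
    ∑ℕ (box ps k) (λ v → withOcc xs (Vec.lookup v)) ≡
    length (filter (λ x → P? x ×-dec Fin.all? λ i → occ (word x) i ∈ℕ? ps) xs)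
  ∑-box-withOcc {ps} u xs = begin
    ∑ℕ (box ps k) (λ v → withOcc xs (Vec.lookup v))
      ≡⟨ ∑ℕ-cong (box ps k) (λ v → length-filter-∑ _ xs) ⟩
    ∑ℕ (box ps k) (λ v → ∑ℕ xs λ x → 𝟙 (P? x ×-dec eq? x v))
      ≡⟨ ∑ℕ-swap (box ps k) xs _ ⟩
    ∑ℕ xs (λ x → ∑ℕ (box ps k) λ v → 𝟙 (P? x ×-dec eq? x v))
      ≡⟨ ∑ℕ-cong xs (λ x → trans (∑ℕ-cong (box ps k) λ v → 𝟙-× (P? x) (eq? x v))
                                 (∑ℕ-*ˡ (𝟙 (P? x)) (box ps k) λ v → 𝟙 (eq? x v))) ⟩
    ∑ℕ xs (λ x → 𝟙 (P? x) * ∑ℕ (box ps k) λ v → 𝟙 (eq? x v))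
      ≡⟨ ∑ℕ-cong xs (λ x → cong (𝟙 (P? x) *_) (inner x)) ⟩
    ∑ℕ xs (λ x → 𝟙 (P? x) * 𝟙 (inBox? x))
      ≡⟨ ∑ℕ-cong xs (λ x → 𝟙-× (P? x) (inBox? x)) ⟨
    ∑ℕ xs (λ x → 𝟙 (P? x ×-dec inBox? x))
      ≡⟨ length-filter-∑ _ xs ⟨
    length (filter (λ x → P? x ×-dec inBox? x) xs) ∎
    where
    open ≡-Reasoning
    eq? : ∀ x v → Dec (∀ i → occ (word x) i ≡ Vec.lookup v i)
    eq? x v = Fin.all? λ i → occ (word x) i ℕ.≟ Vec.lookup v i
    inBox? : ∀ x → Dec (∀ i → occ (word x) i ∈ ps)
    inBox? x = Fin.all? λ i → occ (word x) i ∈ℕ? ps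
    inner : ∀ x → ∑ℕ (box ps k) (λ v → 𝟙 (eq? x v)) ≡ 𝟙 (inBox? x)
    inner x = go (inBox? x)
      where
      go : (d : Dec (∀ i → occ (word x) i ∈ ps)) → ∑ℕ (box ps k) (λ v → 𝟙 (eq? x v)) ≡ 𝟙 d
      go (yes h) = ∑ℕ-𝟙-unique (eq? x) (box-unique u k) (∈-box⁺ k _ h)
        (λ i → sym (Vec.lookup∘tabulate (occ (word x)) i))
        (λ {v} e → trans (sym (Vec.tabulate∘lookup v)) (Vec.tabulate-cong (sym ∘ e)))
      go (no ¬h) = ∑ℕ-𝟙-none (box ps k) (eq? x)
        (λ {v} v∈ e → ¬h λ i → subst (_∈ ps) (sym (e i)) (∈-box⁻ k v∈ i))

-- A series takes a list, so its alphabet is `Fin (length (toList v))`, which is `Fin k` only up to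
-- a propositional equality. Quantifying over `C` lets induction on `v` replace a transport: entries
-- already passed are absorbed into `C` by `_◂_`.
at-toList : (C : ∀ k → (Fin k → ℕ) → ℕ) → (∀ {k f g} → (∀ i → f i ≡ g i) → C k f ≡ C k g) →
  ∀ {k} (v : Vec ℕ k) → C (length (Vec.toList v)) (lookup (Vec.toList v)) ≡ C k (Vec.lookup v)
at-toList C ext Vec.[]        = ext λ ()
at-toList C ext (x Vec.∷ v) = trans (ext λ { zero → refl ; (suc i) → refl })
  (trans (at-toList (λ k f → C (suc k) (x ◂ f)) (λ e → ext λ { zero → refl ; (suc i) → e i }) v)
         (ext λ { zero → refl ; (suc i) → refl }))
  where
  _◂_ : ∀ {k} → ℕ → (Fin k → ℕ) → Fin (suc k) → ℕ
  (x ◂ f) zero    = x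
  (x ◂ f) (suc i) = f i

occ-∈ : ∀ {k} (w : List (Fin k)) i → i ∈ w → 1 ≤ occ w i
occ-∈ w i i∈w = ∈-length (∈-filter⁺ (i Fin.≟_) i∈w refl)

∈-occ : ∀ {k} (w : List (Fin k)) i → 1 ≤ occ w i → i ∈ w
∈-occ w i pos with filter (i Fin.≟_) w in eq
... | j ∷ _ with ∈-filter⁻ (i Fin.≟_) {xs = w} (subst (j ∈_) (sym eq) (here refl))
...   | j∈w , refl = j∈w

occ-≤ : ∀ {k} (w : List (Fin k)) i → occ w i ≤ length w
occ-≤ w i = List.length-filter (i Fin.≟_) w

-- Proper colorings of trees

module _ {k : ℕ} where

  open DecMembership (Fin._≟_ {k}) public using (_∈?_)

  distinct : List (Fin k) → ℕ
  distinct w = ∑ℕ (allFin k) (λ i → 𝟙 (i ∈? w))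

  distinct-cong : ∀ {w w′} → (∀ {i} → i ∈ w → i ∈ w′) → (∀ {i} → i ∈ w′ → i ∈ w) →
    distinct w ≡ distinct w′
  distinct-cong {w} {w′} f g = ∑ℕ-cong (allFin k) (λ i → 𝟙-cong (i ∈? w) (i ∈? w′) f g)

  ∑-const : ∀ x → ∑ℕ (allFin k) (λ _ → x) ≡ k * x
  ∑-const x = trans (const (allFin k)) (cong (_* x) (List.length-tabulate {n = k} id))
    where
    const : (ys : List (Fin k)) → ∑ℕ ys (λ _ → x) ≡ length ys * x
    const []       = refl
    const (y ∷ ys) = cong (x +_) (const ys)

  ∑-≡ : ∀ e → ∑ℕ (allFin k) (λ i → 𝟙 (i Fin.≟ e)) ≡ 1
  ∑-≡ e = ∑ℕ-𝟙-unique (Fin._≟ e) (Unique.allFin⁺ k) (∈-allFin e) refl id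

  distinct-∷-new : ∀ {c w} → c ∉ w → distinct (c ∷ w) ≡ suc (distinct w)
  distinct-∷-new {c} {w} c∉w = begin
    ∑ℕ (allFin k) (λ i → 𝟙 (i ∈? (c ∷ w)))
      ≡⟨ ∑ℕ-cong (allFin k) split ⟩
    ∑ℕ (allFin k) (λ i → 𝟙 (i Fin.≟ c) + 𝟙 (i ∈? w))
      ≡⟨ ∑ℕ-+ (allFin k) _ _ ⟩
    ∑ℕ (allFin k) (λ i → 𝟙 (i Fin.≟ c)) + distinct w
      ≡⟨ cong (_+ distinct w) (∑-≡ c) ⟩
    suc (distinct w) ∎
    where
    open ≡-Reasoning
    split : ∀ i → 𝟙 (i ∈? (c ∷ w)) ≡ 𝟙 (i Fin.≟ c) + 𝟙 (i ∈? w)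
    split i with i Fin.≟ c | i ∈? w
    ... | yes refl | yes i∈w = contradiction i∈w c∉w
    ... | yes refl | no _    = refl
    ... | no _     | yes _   = refl
    ... | no _     | no _    = refl

  -- Total weight of the `k` ways to add a letter to a word with `d` distinct letters: `d` choices
  -- are old, `k ∸ d` are new.
  recolor : (ℕ → ℕ) → ℕ → ℕ
  recolor g d = d * g d + (k ∸ d) * g (suc d)

  ∑-distinct-∷ : ∀ g w → ∑ℕ (allFin k) (λ c → g (distinct (c ∷ w))) ≡ recolor g (distinct w)
  ∑-distinct-∷ g w = begin
    ∑ℕ (allFin k) (λ c → g (distinct (c ∷ w)))
      ≡⟨ ∑ℕ-cong (allFin k) split ⟩
    ∑ℕ (allFin k) (λ c → g d * old c + g (suc d) * new c)
      ≡⟨ ∑ℕ-+ (allFin k) _ _ ⟩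
    ∑ℕ (allFin k) (λ c → g d * old c) + ∑ℕ (allFin k) (λ c → g (suc d) * new c)
      ≡⟨ cong₂ _+_ (∑ℕ-*ˡ (g d) (allFin k) old) (∑ℕ-*ˡ (g (suc d)) (allFin k) new) ⟩
    g d * d + g (suc d) * ∑ℕ (allFin k) new
      ≡⟨ cong₂ _+_ (ℕ.*-comm (g d) d)
           (trans (cong (g (suc d) *_) #new) (ℕ.*-comm (g (suc d)) (k ∸ d))) ⟩
    recolor g d ∎
    where
    open ≡-Reasoning
    d = distinct w
    old new : Fin k → ℕ
    old c = 𝟙 (c ∈? w)
    new c = 𝟙 (¬? (c ∈? w))
    split : ∀ c → g (distinct (c ∷ w)) ≡ g d * old c + g (suc d) * new c
    split c with c ∈? w
    ... | yes c∈w rewrite distinct-cong {c ∷ w} {w} (λ { (here refl) → c∈w ; (there i∈w) → i∈w }) there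
                        | ℕ.*-identityʳ (g d) | ℕ.*-zeroʳ (g (suc d)) = sym (ℕ.+-identityʳ (g d))
    ... | no  c∉w rewrite distinct-∷-new c∉w | ℕ.*-zeroʳ (g d) = sym (ℕ.*-identityʳ (g (suc d)))
    total : ∀ c → old c + new c ≡ 1
    total c with c ∈? w
    ... | yes _ = refl
    ... | no _  = refl
    #new : ∑ℕ (allFin k) new ≡ k ∸ d
    #new = begin
      ∑ℕ (allFin k) new                    ≡⟨ ℕ.m+n∸m≡n d _ ⟨
      d + ∑ℕ (allFin k) new ∸ d            ≡⟨ cong (_∸ d) (∑ℕ-+ (allFin k) old new) ⟨
      ∑ℕ (allFin k) (λ c → old c + new c) ∸ d ≡⟨ cong (_∸ d) (∑ℕ-cong (allFin k) total) ⟩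
      ∑ℕ (allFin k) (λ _ → 1) ∸ d          ≡⟨ cong (_∸ d) (trans (∑-const 1) (ℕ.*-identityʳ k)) ⟩
      k ∸ d                                ∎

  -- The excluded color `e` is an old one and so accounts for exactly one `g d` of the full sum;
  -- this makes the truncated subtraction exact.
  ∑-≢-distinct-∷ : ∀ g {e w} → e ∈ w →
    ∑ℕ (allFin k) (λ c → 𝟙 (¬? (c Fin.≟ e)) * g (distinct (c ∷ w))) ≡
    recolor g (distinct w) ∸ g (distinct w)
  ∑-≢-distinct-∷ g {e} {w} e∈w = begin
    S                                         ≡⟨ ℕ.m+n∸n≡m S (g d) ⟨
    S + g d ∸ g d                             ≡⟨ cong (λ x → S + x ∸ g d) atE ⟨
    S + ∑ℕ (allFin k) (λ c → g d * 𝟙 (c Fin.≟ e)) ∸ g d ≡⟨ cong (_∸ g d) (∑ℕ-+ (allFin k) _ _) ⟨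
    ∑ℕ (allFin k) (λ c → 𝟙 (¬? (c Fin.≟ e)) * g (distinct (c ∷ w)) + g d * 𝟙 (c Fin.≟ e)) ∸ g d
      ≡⟨ cong (_∸ g d) (trans (∑ℕ-cong (allFin k) merge) (∑-distinct-∷ g w)) ⟩
    recolor g d ∸ g d ∎
    where
    open ≡-Reasoning
    d = distinct w
    S = ∑ℕ (allFin k) (λ c → 𝟙 (¬? (c Fin.≟ e)) * g (distinct (c ∷ w)))
    atE : ∑ℕ (allFin k) (λ c → g d * 𝟙 (c Fin.≟ e)) ≡ g d
    atE = trans (∑ℕ-*ˡ (g d) (allFin k) _) (trans (cong (g d *_) (∑-≡ e)) (ℕ.*-identityʳ (g d)))
    merge : ∀ c → 𝟙 (¬? (c Fin.≟ e)) * g (distinct (c ∷ w)) + g d * 𝟙 (c Fin.≟ e) ≡ g (distinct (c ∷ w))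
    merge c with c Fin.≟ e
    ... | yes refl = trans (ℕ.*-identityʳ (g d))
            (cong g (sym (distinct-cong {c ∷ w} {w} (λ { (here refl) → e∈w ; (there i∈w) → i∈w }) there)))
    ... | no _     = trans (cong (1 * g (distinct (c ∷ w)) +_) (ℕ.*-zeroʳ (g d)))
            (trans (ℕ.+-identityʳ _) (ℕ.*-identityˡ _))

  distinct≡k⇒∈ : ∀ w → distinct w ≡ k → ∀ i → i ∈ w
  distinct≡k⇒∈ w d≡k i = proj₂ (∈-filter⁻ (_∈? w) {xs = allFin k}
    (subst (i ∈_) (sym (List.filter-complete (_∈? w) full)) (∈-allFin i)))
    where
    full : length (filter (_∈? w) (allFin k)) ≡ length (allFin k)
    full = trans (length-filter-∑ (_∈? w) (allFin k)) (trans d≡k (sym (List.length-tabulate {n = k} id)))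

  ∈⇒distinct≡k : ∀ w → (∀ i → i ∈ w) → distinct w ≡ k
  ∈⇒distinct≡k w all∈ = trans (∑ℕ-cong (allFin k) (λ i → 𝟙-yes (i ∈? w) (all∈ i)))
    (trans (∑-const 1) (ℕ.*-identityʳ k))

-- Each vector arises from exactly `k` pairs of a vector and a color, since the entry overwritten at
-- `v` is arbitrary.
∑-words-update : ∀ {k n} (v : Fin n) (h : Vec (Fin k) n → ℕ) →
  ∑ℕ (words k n) (λ κ → ∑ℕ (allFin k) (λ c → h (κ Vec.[ v ]≔ c))) ≡ k * ∑ℕ (words k n) h
∑-words-update {k} {suc n} zero h = begin
  ∑ℕ (words k (suc n)) (λ κ → ∑ℕ (allFin k) (λ c → h (κ Vec.[ zero ]≔ c)))
    ≡⟨ ∑ℕ-cartesianProductWith Vec._∷_ (allFin k) (words k n) _ ⟩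
  ∑ℕ (allFin k) (λ _ → ∑ℕ (words k n) (λ κ → ∑ℕ (allFin k) (λ c → h (c Vec.∷ κ))))
    ≡⟨ ∑-const {k} (∑ℕ (words k n) λ κ → ∑ℕ (allFin k) λ c → h (c Vec.∷ κ)) ⟩
  k * ∑ℕ (words k n) (λ κ → ∑ℕ (allFin k) (λ c → h (c Vec.∷ κ)))
    ≡⟨ cong (k *_) (∑ℕ-swap (words k n) (allFin k) _) ⟩
  k * ∑ℕ (allFin k) (λ c → ∑ℕ (words k n) (λ κ → h (c Vec.∷ κ)))
    ≡⟨ cong (k *_) (∑ℕ-cartesianProductWith Vec._∷_ (allFin k) (words k n) h) ⟨
  k * ∑ℕ (words k (suc n)) h ∎
  where open ≡-Reasoning
∑-words-update {k} {suc n} (suc v) h = begin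
  ∑ℕ (words k (suc n)) (λ κ → ∑ℕ (allFin k) (λ c → h (κ Vec.[ suc v ]≔ c)))
    ≡⟨ ∑ℕ-cartesianProductWith Vec._∷_ (allFin k) (words k n) _ ⟩
  ∑ℕ (allFin k) (λ e → ∑ℕ (words k n) (λ κ → ∑ℕ (allFin k) (λ c → h (e Vec.∷ (κ Vec.[ v ]≔ c)))))
    ≡⟨ ∑ℕ-cong (allFin k) (λ e → ∑-words-update v (λ κ → h (e Vec.∷ κ))) ⟩
  ∑ℕ (allFin k) (λ e → k * ∑ℕ (words k n) (λ κ → h (e Vec.∷ κ)))
    ≡⟨ ∑ℕ-*ˡ k (allFin k) _ ⟩
  k * ∑ℕ (allFin k) (λ c → ∑ℕ (words k n) (λ κ → h (c Vec.∷ κ)))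
    ≡⟨ cong (k *_) (∑ℕ-cartesianProductWith Vec._∷_ (allFin k) (words k n) h) ⟨
  k * ∑ℕ (words k (suc n)) h ∎
  where open ≡-Reasoning

-- Counting colorings leaf by leaf

module _ {n : ℕ} (G : Graph n) where
  open Graph G

  -- Read from the right, this builds the graph on the listed vertices from a root by attaching one
  -- leaf at a time. The counting sees nothing else of a tree.
  data LeafOrder : List (Fin n) → Set where
    []   : LeafOrder []
    root : ∀ v → LeafOrder (v ∷ [])
    leaf : ∀ {v u vs} → v ∉ vs → u ∈ vs → v ∼ u → (∀ {w} → w ∈ vs → v ∼ w → w ≡ u) →
           LeafOrder vs → LeafOrder (v ∷ vs)

  module _ {k : ℕ} where

    ProperOn : List (Fin n) → Vec (Fin k) n → Set
    ProperOn vs κ = All (λ a → All (λ b → a ∼ b → Vec.lookup κ a ≢ Vec.lookup κ b) vs) vs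

    properOn? : ∀ vs κ → Dec (ProperOn vs κ)
    properOn? vs κ = All.all? (λ a → All.all? (λ b →
      (a ∼? b) →-dec ¬? (Vec.lookup κ a Fin.≟ Vec.lookup κ b)) vs) vs

    colors : List (Fin n) → Vec (Fin k) n → List (Fin k)
    colors vs κ = map (Vec.lookup κ) vs

    -- All `n` vertices are colored, but properness and the number of colors are measured on `vs`
    -- only. The index set thus stays fixed while `vs` shrinks, at the price of a factor `k` per
    -- vertex removed. The weight is arbitrary because removing a leaf changes it.
    weightedColorings : List (Fin n) → (ℕ → ℕ) → ℕ
    weightedColorings vs g = ∑ℕ (words k n) (λ κ → 𝟙 (properOn? vs κ) * g (distinct (colors vs κ)))

    colors-update : ∀ {v} vs κ c → v ∉ vs → colors (v ∷ vs) (κ Vec.[ v ]≔ c) ≡ c ∷ colors vs κ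
    colors-update {v} vs κ c v∉vs = cong₂ _∷_ (Vec.lookup∘update v κ c)
      (List.map-cong-local (All.tabulate λ {w} w∈vs → Vec.lookup∘update′ (λ { refl → v∉vs w∈vs }) κ c))

    properOn-update⁺ : ∀ {v u vs} κ c → v ∉ vs → (∀ {w} → w ∈ vs → v ∼ w → w ≡ u) →
      ProperOn vs κ → c ≢ Vec.lookup κ u → ProperOn (v ∷ vs) (κ Vec.[ v ]≔ c)
    properOn-update⁺ {v} {u} {vs} κ c v∉vs only prop c≢ =
      ((λ v∼v → contradiction v∼v (∼-irrefl refl)) ∷ All.tabulate (λ w∈ v∼w → new w∈ v∼w)) ∷
      All.tabulate (λ {a} a∈ → (λ a∼v e → new a∈ (∼-sym a∼v) (sym e)) ∷
        All.tabulate (λ {b} b∈ a∼b e → All.lookup (All.lookup prop a∈) b∈ a∼b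
          (trans (sym (same a∈)) (trans e (same b∈)))))
      where
      same : ∀ {w} → w ∈ vs → Vec.lookup (κ Vec.[ v ]≔ c) w ≡ Vec.lookup κ w
      same w∈vs = Vec.lookup∘update′ (λ { refl → v∉vs w∈vs }) κ c
      new : ∀ {w} → w ∈ vs → v ∼ w → Vec.lookup (κ Vec.[ v ]≔ c) v ≢ Vec.lookup (κ Vec.[ v ]≔ c) w
      new w∈ v∼w e with only w∈ v∼w
      ... | refl = c≢ (trans (sym (Vec.lookup∘update v κ c)) (trans e (same w∈)))

    properOn-update⁻ : ∀ {v u vs} κ c → v ∉ vs → u ∈ vs → v ∼ u →
      ProperOn (v ∷ vs) (κ Vec.[ v ]≔ c) → ProperOn vs κ × c ≢ Vec.lookup κ u
    properOn-update⁻ {v} {u} {vs} κ c v∉vs u∈vs v∼u ((_ ∷ pv) ∷ pvs) =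
      All.tabulate (λ {a} a∈ → All.tabulate (λ {b} b∈ a∼b e →
        All.lookup (All.tail (All.lookup pvs a∈)) b∈ a∼b (trans (same a∈) (trans e (sym (same b∈)))))) ,
      λ e → All.lookup pv u∈vs v∼u (trans (Vec.lookup∘update v κ c) (trans e (sym (same u∈vs))))
      where
      same : ∀ {w} → w ∈ vs → Vec.lookup (κ Vec.[ v ]≔ c) w ≡ Vec.lookup κ w
      same w∈vs = Vec.lookup∘update′ (λ { refl → v∉vs w∈vs }) κ c

    -- Averaging over the color of v: every coloring arises from k updates.
    weightedColorings-root : ∀ v g → k * weightedColorings (v ∷ []) g ≡ weightedColorings [] (recolor {k} g)
    weightedColorings-root v g = trans (sym (∑-words-update v _))
      (∑ℕ-cong (words k n) λ κ → begin
        ∑ℕ (allFin k) (λ c → 𝟙 (properOn? (v ∷ []) (κ Vec.[ v ]≔ c)) *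
                             g (distinct (colors (v ∷ []) (κ Vec.[ v ]≔ c))))
          ≡⟨ ∑ℕ-cong (allFin k) (λ c → cong₂ _*_
               (𝟙-yes (properOn? (v ∷ []) (κ Vec.[ v ]≔ c))
                 (((λ v∼v → contradiction v∼v (∼-irrefl refl)) ∷ []) ∷ []))
               (cong (g ∘ distinct) (colors-update [] κ c λ ()))) ⟩
        ∑ℕ (allFin k) (λ c → 1 * g (distinct (c ∷ [])))
          ≡⟨ ∑ℕ-*ˡ 1 (allFin k) _ ⟩
        1 * ∑ℕ (allFin k) (λ c → g (distinct (c ∷ [])))
          ≡⟨ cong (1 *_) (∑-distinct-∷ {k} g []) ⟩
        1 * recolor {k} g (distinct {k} []) ∎)
      where open ≡-Reasoning

    -- Once `vs` is colored, the leaf may take any color but that of `u`, which is among the `d`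
    -- colors present. The resulting weight is a function of `d` alone: no trace of `u` or of the
    -- shape of the graph is left.
    weightedColorings-leaf : ∀ {v u vs} → v ∉ vs → u ∈ vs → v ∼ u → (∀ {w} → w ∈ vs → v ∼ w → w ≡ u) →
      ∀ g → k * weightedColorings (v ∷ vs) g ≡ weightedColorings vs (λ d → recolor {k} g d ∸ g d)
    weightedColorings-leaf {v} {u} {vs} v∉vs u∈vs v∼u only g = trans (sym (∑-words-update v _))
      (∑ℕ-cong (words k n) λ κ → begin
        ∑ℕ (allFin k) (λ c → 𝟙 (properOn? (v ∷ vs) (κ Vec.[ v ]≔ c)) *
                             g (distinct (colors (v ∷ vs) (κ Vec.[ v ]≔ c))))
          ≡⟨ ∑ℕ-cong (allFin k) (λ c → cong₂ _*_ (proper κ c)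
               (cong (g ∘ distinct) (colors-update vs κ c v∉vs))) ⟩
        ∑ℕ (allFin k) (λ c → 𝟙 (properOn? vs κ) * 𝟙 (¬? (c Fin.≟ Vec.lookup κ u)) *
                             g (distinct (c ∷ colors vs κ)))
          ≡⟨ ∑ℕ-cong (allFin k) (λ c → ℕ.*-assoc (𝟙 (properOn? vs κ)) _ _) ⟩
        ∑ℕ (allFin k) (λ c → 𝟙 (properOn? vs κ) * (𝟙 (¬? (c Fin.≟ Vec.lookup κ u)) *
                             g (distinct (c ∷ colors vs κ))))
          ≡⟨ ∑ℕ-*ˡ (𝟙 (properOn? vs κ)) (allFin k) _ ⟩
        𝟙 (properOn? vs κ) * ∑ℕ (allFin k) (λ c → 𝟙 (¬? (c Fin.≟ Vec.lookup κ u)) *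
                             g (distinct (c ∷ colors vs κ)))
          ≡⟨ cong (𝟙 (properOn? vs κ) *_) (∑-≢-distinct-∷ g (∈-map⁺ (Vec.lookup κ) u∈vs)) ⟩
        𝟙 (properOn? vs κ) * (recolor {k} g (distinct (colors vs κ)) ∸ g (distinct (colors vs κ))) ∎)
      where
      open ≡-Reasoning
      proper : ∀ κ c → 𝟙 (properOn? (v ∷ vs) (κ Vec.[ v ]≔ c)) ≡
        𝟙 (properOn? vs κ) * 𝟙 (¬? (c Fin.≟ Vec.lookup κ u))
      proper κ c = trans
        (𝟙-cong (properOn? (v ∷ vs) (κ Vec.[ v ]≔ c)) (properOn? vs κ ×-dec ¬? (c Fin.≟ Vec.lookup κ u))
          (properOn-update⁻ κ c v∉vs u∈vs v∼u)
          (λ (prop , c≢) → properOn-update⁺ κ c v∉vs only prop c≢))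
        (𝟙-× (properOn? vs κ) (¬? (c Fin.≟ Vec.lookup κ u)))

-- Removing a leaf from either graph leads to the same new weight, to which the induction hypothesis
-- applies.
leafOrder-colorings : ∀ {k n} (G H : Graph n) {vs ws} → LeafOrder G vs → LeafOrder H ws →
  length vs ≡ length ws → ∀ g →
  k ^ length vs * weightedColorings G {k} vs g ≡ k ^ length vs * weightedColorings H {k} ws g
leafOrder-colorings {k} G H [] [] _ g = refl
leafOrder-colorings {k} G H (root v) (root w) _ g = begin
  k * 1 * weightedColorings G {k} (v ∷ []) g ≡⟨ cong (_* weightedColorings G {k} (v ∷ []) g) (ℕ.*-identityʳ k) ⟩
  k * weightedColorings G {k} (v ∷ []) g     ≡⟨ weightedColorings-root G {k} v g ⟩
  -- On the empty list `G` and `H` give the same expression by computation.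
  weightedColorings G {k} [] (recolor {k} g) ≡⟨ weightedColorings-root H {k} w g ⟨
  k * weightedColorings H {k} (w ∷ []) g     ≡⟨ cong (_* weightedColorings H {k} (w ∷ []) g) (ℕ.*-identityʳ k) ⟨
  k * 1 * weightedColorings H {k} (w ∷ []) g ∎
  where open ≡-Reasoning
leafOrder-colorings {k} G H (leaf {vs = vs} v∉ u∈ v∼u only o) (leaf {vs = ws} v∉′ u∈′ v∼u′ only′ o′) len g =
  begin
  k * k ^ length vs * weightedColorings G {k} (_ ∷ vs) g
    ≡⟨ pull (weightedColorings G {k} (_ ∷ vs) g) ⟩
  k ^ length vs * (k * weightedColorings G {k} (_ ∷ vs) g)
    ≡⟨ cong (k ^ length vs *_) (weightedColorings-leaf G {k} v∉ u∈ v∼u only g) ⟩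
  k ^ length vs * weightedColorings G {k} vs (λ d → recolor {k} g d ∸ g d)
    ≡⟨ leafOrder-colorings G H o o′ (ℕ.suc-injective len) (λ d → recolor {k} g d ∸ g d) ⟩
  k ^ length vs * weightedColorings H {k} ws (λ d → recolor {k} g d ∸ g d)
    ≡⟨ cong (k ^ length vs *_) (weightedColorings-leaf H {k} v∉′ u∈′ v∼u′ only′ g) ⟨
  k ^ length vs * (k * weightedColorings H {k} (_ ∷ ws) g)
    ≡⟨ pull (weightedColorings H {k} (_ ∷ ws) g) ⟨
  k * k ^ length vs * weightedColorings H {k} (_ ∷ ws) g ∎
  where
  open ≡-Reasoning
  pull : ∀ x → k * k ^ length vs * x ≡ k ^ length vs * (k * x)
  pull x = trans (cong (_* x) (ℕ.*-comm k (k ^ length vs))) (ℕ.*-assoc (k ^ length vs) k x)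
leafOrder-colorings G H (root _) (leaf _ () _ _ []) len g
leafOrder-colorings G H (leaf _ () _ _ []) (root _) len g

-- Leaf orders of trees

module _ {n : ℕ} (G : Graph n) where
  open Graph G

  data Path : Fin n → Fin n → List (Fin n) → Set where
    stop : ∀ {a} → Path a a (a ∷ [])
    _◅_  : ∀ {a b c p} → a ∼ b → Path b c p → Path a c (a ∷ p)

  path-∷ʳ : ∀ {a b c p} → Path a b p → b ∼ c → Path a c (p ∷ʳ c)
  path-∷ʳ stop      b∼c = b∼c ◅ stop
  path-∷ʳ (a∼ ◅ p)  b∼c = a∼ ◅ path-∷ʳ p b∼c

  path-closed : ∀ {a b p x y} → x ∼ a → Path a b p → b ∼ y → Linked _∼_ (x ∷ (p ∷ʳ y))
  path-closed x∼a stop     b∼y = x∼a ∷ b∼y ∷ [-]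
  path-closed x∼a (a∼ ◅ p) b∼y = x∼a ∷ path-closed a∼ p b∼y

  path-length : ∀ {a b p} → a ≢ b → Path a b p → 2 ≤ length p
  path-length a≢b stop           = contradiction refl a≢b
  path-length a≢b (_ ◅ stop)     = s≤s (s≤s z≤n)
  path-length a≢b (_ ◅ (_ ◅ _))  = s≤s (s≤s z≤n)

  PathWithin : List (Fin n) → Fin n → Fin n → Set
  PathWithin vs a b = ∃ λ p → Path a b p × Unique p × All (_∈ vs) p

  -- The paths are kept simple and inside `vs` so that, together with a vertex outside `vs`, they
  -- meet the distinctness clause of `IsCycle`.
  record Subtree (vs : List (Fin n)) : Set where
    field
      order  : LeafOrder G vs
      unique : Unique vs
      paths  : ∀ {a b} → a ∈ vs → b ∈ vs → PathWithin vs a b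

  open Subtree

  singleton : ∀ v → Subtree (v ∷ [])
  singleton v .order  = root v
  singleton v .unique = [] ∷ []
  singleton v .paths (here refl) (here refl) = _ , stop , [] ∷ [] , here refl ∷ []

  ∉⇒All-≢ : ∀ {v} {vs p : List (Fin n)} → v ∉ vs → All (_∈ vs) p → All (v ≢_) p
  ∉⇒All-≢ v∉vs = All.map λ w∈vs → λ { refl → v∉vs w∈vs }

  -- Two neighbors of v inside the subtree would close a cycle through v.
  attach : Acyclic G → ∀ {u v vs} → Subtree vs → u ∈ vs → v ∉ vs → u ∼ v → Subtree (v ∷ vs)
  attach acyclic {u} {v} {vs} S u∈vs v∉vs u∼v = λ where
      .order  → leaf v∉vs u∈vs (∼-sym u∼v) only (S .order)
      .unique → All.tabulate (λ w∈vs → λ { refl → v∉vs w∈vs }) ∷ S .unique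
      .paths (here refl) (here refl) → _ , stop , [] ∷ [] , here refl ∷ []
      .paths (here refl) (there b∈)  → let p , path , u! , p⊆ = S .paths u∈vs b∈ in
        _ , ∼-sym u∼v ◅ path , ∉⇒All-≢ v∉vs p⊆ ∷ u! , here refl ∷ All.map there p⊆
      .paths (there a∈)  (here refl) → let p , path , u! , p⊆ = S .paths a∈ u∈vs in
        _ , path-∷ʳ path u∼v ,
        Unique.++⁺ u! ([] ∷ []) (λ { (w∈p , here refl) → v∉vs (All.lookup p⊆ w∈p) }) ,
        All.∷ʳ⁺ (All.map there p⊆) (here refl)
      .paths (there a∈)  (there b∈)  → let p , path , u! , p⊆ = S .paths a∈ b∈ in
        _ , path , u! , All.map there p⊆
    where
    only : ∀ {w} → w ∈ vs → v ∼ w → w ≡ u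
    only {w} w∈vs v∼w with w Fin.≟ u
    ... | yes w≡u = w≡u
    ... | no  w≢u = let p , path , u! , p⊆ = S .paths u∈vs w∈vs in contradiction
      (path-length (w≢u ∘ sym) path , ∉⇒All-≢ v∉vs p⊆ ∷ u! , path-closed (∼-sym u∼v) path (∼-sym v∼w))
      (acyclic v p)

  -- Take the first step of the walk that leaves `vs`.
  boundary : ∀ {vs a b} → Star _∼_ a b → a ∈ vs → b ∉ vs → ∃₂ λ u v → u ∈ vs × v ∉ vs × u ∼ v
  boundary ε a∈ b∉ = contradiction a∈ b∉
  boundary {vs} (_◅_ {j = c} a∼c walk) a∈ b∉ with c ∈? vs
  ... | yes c∈ = boundary walk c∈ b∉
  ... | no  c∉ = _ , _ , a∈ , c∉ , a∼c

  missing : ∀ vs → length vs < n → ∃ λ v → v ∉ vs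
  missing vs short with Fin.all? (_∈? vs)
  ... | no ¬all = Fin.¬∀⟶∃¬ n _ (_∈? vs) ¬all
  ... | yes all = contradiction
    (ℕ.≤-trans (ℕ.≤-reflexive (sym (List.length-tabulate id)))
      (unique-⊆-length vs (Unique.allFin⁺ n) (λ {x} _ → all x)))
    (ℕ.<⇒≱ short)

  -- Connectedness supplies an edge leaving the current vertex set, and acyclicity makes its outer
  -- end a leaf.
  subtree : IsTree G → ∀ m → suc m ≤ n → ∃ λ vs → length vs ≡ suc m × Subtree vs
  subtree _ zero 0<n = _ , refl , singleton (Fin.fromℕ< 0<n)
  subtree tree@(connected , acyclic) (suc m) m<n with subtree tree m (ℕ.<⇒≤ m<n)
  ... | vs@(r ∷ _) , len , S with missing vs (subst (_< n) (sym len) m<n)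
  -- The missing `v` only gives the walk a target; the vertex attached is the first one outside `vs`
  -- on the way.
  ...   | v , v∉vs with boundary (connected r v) (here refl) v∉vs
  ...     | _ , _ , u∈ , w∉ , u∼w = _ , cong suc len , attach acyclic S u∈ w∉ u∼w

  tree-leafOrder : IsTree G → ∃ λ vs → length vs ≡ n × (∀ v → v ∈ vs) × LeafOrder G vs
  tree-leafOrder tree = go n refl
    where
    go : ∀ m → m ≡ n → ∃ λ vs → length vs ≡ n × (∀ v → v ∈ vs) × LeafOrder G vs
    go zero    refl = [] , refl , (λ ()) , []
    go (suc m) refl with subtree tree m ℕ.≤-refl
    ... | vs , len , S = vs , len , all∈ , S .order
      where
      all∈ : ∀ v → v ∈ vs
      -- Otherwise `v ∷ vs` would list more distinct vertices than there are.
      all∈ v with v ∈? vs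
      ... | yes v∈ = v∈
      ... | no  v∉ = contradiction
        (subst₂ _≤_ (cong suc len) (List.length-tabulate id)
          (unique-⊆-length (allFin n) (All.tabulate (λ w∈vs → λ { refl → v∉ w∈vs }) ∷ S .unique)
            (λ {x} _ → ∈-allFin x)))
        ℕ.1+n≰n

-- Coloring counts shared by all trees

properColorings-distinct : ∀ {k n} (G : Graph n) {Q : Vec (Fin k) n → Set}
  (Q? : ∀ κ → Dec (Q κ)) (g : ℕ → ℕ) → (∀ κ → 𝟙 (Q? κ) ≡ g (distinct (Vec.toList κ))) →
  ∀ {vs} → (∀ v → v ∈ vs) →
  length (filter (λ κ → properColoring? G κ ×-dec Q? κ) (words k n)) ≡ weightedColorings G vs g
properColorings-distinct {k} {n} G Q? g Q≡g {vs} all∈ = trans (length-filter-∑ _ (words k n))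
  (∑ℕ-cong (words k n) λ κ → trans (𝟙-× (properColoring? G κ) (Q? κ)) (cong₂ _*_
    (𝟙-cong (properColoring? G κ) (properOn? G vs κ)
      (λ prop → All.tabulate λ {a} _ → All.tabulate λ {b} _ → prop a b)
      (λ prop a b → All.lookup (All.lookup prop (all∈ a)) (all∈ b)))
    (trans (Q≡g κ) (cong g (distinct-cong
      (λ i∈κ → let v , i≡ = ∈-toList⁻ κ i∈κ in
        subst (_∈ colors G vs κ) (sym i≡) (∈-map⁺ (Vec.lookup κ) (all∈ v)))
      (λ i∈ → let v , _ , i≡ = ∈-map⁻ (Vec.lookup κ) i∈ in
        subst (_∈ Vec.toList κ) (sym i≡) (VecMembership.∈-toList⁺ (VecMembership.∈-lookup v κ))))))))
  where
  ∈-toList⁻ : ∀ {m i} (κ : Vec (Fin k) m) → i ∈ Vec.toList κ → ∃ λ v → i ≡ Vec.lookup κ v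
  ∈-toList⁻ (c Vec.∷ κ) (here i≡c) = zero , i≡c
  ∈-toList⁻ (c Vec.∷ κ) (there i∈) = let v , e = ∈-toList⁻ κ i∈ in suc v , e

tree-colorings : ∀ {k n} (G H : Graph n) → IsTree G → IsTree H →
  {Q : Vec (Fin k) n → Set} (Q? : ∀ κ → Dec (Q κ)) (g : ℕ → ℕ) →
  (∀ κ → 𝟙 (Q? κ) ≡ g (distinct (Vec.toList κ))) →
  length (filter (λ κ → properColoring? G κ ×-dec Q? κ) (words k n)) ≡
  length (filter (λ κ → properColoring? H κ ×-dec Q? κ) (words k n))
-- The power of `k` cannot be cancelled for `k = 0` in general. In that case either there is no
-- vertex and properness is vacuous, or there is a vertex and no coloring.
tree-colorings {zero} {zero} G H _ _ Q? g Q≡g = cong length (List.filter-≐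
  (λ κ → properColoring? G κ ×-dec Q? κ) (λ κ → properColoring? H κ ×-dec Q? κ)
  ((λ (_ , q) → (λ ()) , q) , (λ (_ , q) → (λ ()) , q)) (words 0 0))
tree-colorings {zero} {suc n} G H _ _ Q? g Q≡g = refl
tree-colorings {suc k} {n} G H treeG treeH Q? g Q≡g
  with tree-leafOrder G treeG | tree-leafOrder H treeH
... | vs , len , all∈ , order | ws , len′ , all∈′ , order′ = begin
  _                        ≡⟨ properColorings-distinct G Q? g Q≡g all∈ ⟩
  weightedColorings G vs g ≡⟨ ℕ.*-cancelˡ-≡ _ _ (suc k ^ length vs) {{ℕ.m^n≢0 (suc k) (length vs)}}
                              (leafOrder-colorings G H order order′ (trans len (sym len′)) g) ⟩
  weightedColorings H ws g ≡⟨ properColorings-distinct H Q? g Q≡g all∈′ ⟨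
  _                        ∎
  where open ≡-Reasoning

-- Packed semistandard tableaux

words-unique : ∀ k m → Unique (words k m)
words-unique k zero    = [] ∷ []
words-unique k (suc m) =
  Unique.cartesianProductWith⁺ Vec._∷_ Vec.∷-injective (Unique.allFin⁺ k) (words-unique k m)

∈-words : ∀ {k m} (κ : Vec (Fin k) m) → κ ∈ words k m
∈-words Vec.[]      = here refl
∈-words (c Vec.∷ κ) = ∈-cartesianProductWith⁺ Vec._∷_ (∈-allFin c) (∈-words κ)

fillings-unique : ∀ k λs → Unique (fillings k λs)
fillings-unique k []       = [] ∷ []
fillings-unique k (l ∷ λs) = Unique.cartesianProductWith⁺ _∷_ List.∷-injective
  (Unique.map⁺ (λ {x} {y} e → trans (sym (Vec.cast-is-id refl x)) (Vec.toList-injective refl x y e))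
    (words-unique k l))
  (fillings-unique k λs)

∈-fillings⁺ : ∀ {k} (T : Tableau k) → T ∈ fillings k (map length T)
∈-fillings⁺ []      = here refl
∈-fillings⁺ (r ∷ T) = ∈-cartesianProductWith⁺ _∷_
  (subst (_∈ map Vec.toList (words _ (length r))) (Vec.toList∘fromList r)
         (∈-map⁺ Vec.toList (∈-words (Vec.fromList r))))
  (∈-fillings⁺ T)

∈-fillings⁻ : ∀ {k} λs {T : Tableau k} → T ∈ fillings k λs → map length T ≡ λs
∈-fillings⁻         []       (here refl) = refl
∈-fillings⁻ {k} (l ∷ λs) T∈ with ∈-cartesianProductWith⁻ _∷_ (map Vec.toList (words k l))
                              (fillings k λs) T∈
... | _ , _ , r∈ , T′∈ , refl with ∈-map⁻ Vec.toList r∈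
...   | κ , _ , refl = cong₂ _∷_ (Vec.length-toList κ) (∈-fillings⁻ λs T′∈)

length-concat : ∀ {k} (T : Tableau k) → length (concat T) ≡ sum (map length T)
length-concat []      = refl
length-concat (r ∷ T) = trans (List.length-++ r) (cong (length r +_) (length-concat T))

module _ {k : ℕ} where

  Packed : Tableau k → Set
  Packed T = ∀ i → i ∈ concat T

  packed? : ∀ T → Dec (Packed T)
  packed? T = Fin.all? λ i → i ∈? concat T

packedTableaux : (k : ℕ) → List ℕ → List (Tableau k)
packedTableaux k λs = filter (λ T → semistandard? T ×-dec packed? T) (fillings k λs)

record IsPackedTableau (k : ℕ) (λs : List ℕ) (T : Tableau k) : Set where
  constructor isPackedTableau
  field
    shape  : map length T ≡ λs
    ss     : Semistandard T
    packed : Packed T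

open IsPackedTableau

∈-packedTableaux⁺ : ∀ {k λs T} → IsPackedTableau k λs T → T ∈ packedTableaux k λs
∈-packedTableaux⁺ {k} {λs} {T} (isPackedTableau refl ss packed) =
  ∈-filter⁺ (λ T → semistandard? T ×-dec packed? T) (∈-fillings⁺ T) (ss , packed)

∈-packedTableaux⁻ : ∀ k λs {T} → T ∈ packedTableaux k λs → IsPackedTableau k λs T
∈-packedTableaux⁻ k λs T∈ with ∈-filter⁻ (λ T → semistandard? T ×-dec packed? T) {xs = fillings k λs} T∈
... | T∈′ , ss , packed = isPackedTableau (∈-fillings⁻ λs T∈′) ss packed

packed-letters-≤ : ∀ {k λs T} → IsPackedTableau k λs T → k ≤ sum λs
packed-letters-≤ {k} {T = T} (isPackedTableau refl _ packed) =
  subst₂ _≤_ (List.length-tabulate {n = k} id) (length-concat T)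
    (unique-⊆-length (concat T) (Unique.allFin⁺ k) (λ {i} _ → packed i))

-- Splitting and merging letters

pinch-punchIn : ∀ {k} (p h : Fin k) → pinch p (punchIn (suc p) h) ≡ h
pinch-punchIn p       zero    = refl
pinch-punchIn zero    (suc h) = refl
pinch-punchIn (suc p) (suc h) = cong suc (pinch-punchIn p h)

punchIn-pinch : ∀ {k} (p : Fin k) h → h ≢ suc p → punchIn (suc p) (pinch p h) ≡ h
punchIn-pinch {suc k} p       zero          h≢ = refl
punchIn-pinch {suc k} zero    (suc zero)    h≢ = contradiction refl h≢
punchIn-pinch {suc k} zero    (suc (suc h)) h≢ = refl
punchIn-pinch {suc k} (suc p) (suc h)       h≢ = cong suc (punchIn-pinch p h (h≢ ∘ cong suc))

pinch-suc : ∀ {k} {p c : Fin k} → p Fin.≤ c → pinch p (suc c) ≡ c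
pinch-suc {p = zero}              p≤c       = refl
pinch-suc {p = suc p} {c = suc c} (s≤s p≤c) = cong suc (pinch-suc p≤c)

suc-pinch : ∀ {k} {p : Fin k} {c} → suc p Fin.≤ c → suc (pinch p c) ≡ c
suc-pinch {p = p} {c = suc c} (s≤s p≤c) = cong suc (pinch-suc p≤c)

pinch-inject₁ : ∀ {k} (p : Fin k) → pinch p (inject₁ p) ≡ p
pinch-inject₁ zero    = refl
pinch-inject₁ (suc p) = cong suc (pinch-inject₁ p)

-- `pinch p` identifies only `p` with `suc p`, so the one strict inequality it destroys is the one
-- between these two.
pinch-mono-< : ∀ {k} (p : Fin k) {c d} → c Fin.< d → d ≢ suc p → pinch p c Fin.< pinch p d
pinch-mono-< {suc k} zero    {zero}  {suc zero}    c<d       d≢ = contradiction refl d≢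
pinch-mono-< {suc k} zero    {zero}  {suc (suc d)} c<d       d≢ = s≤s z≤n
pinch-mono-< {suc k} zero    {suc c} {suc d}       (s≤s c<d) d≢ = c<d
pinch-mono-< {suc k} (suc p) {zero}  {suc d}       c<d       d≢ = s≤s z≤n
pinch-mono-< {suc k} (suc p) {suc c} {suc d}       (s≤s c<d) d≢ = s≤s (pinch-mono-< p c<d (d≢ ∘ cong suc))

punchIn-mono-< : ∀ {k} i {c d : Fin k} → c Fin.< d → punchIn i c Fin.< punchIn i d
punchIn-mono-< i {c} {d} c<d = ℕ.≰⇒> (ℕ.<⇒≱ c<d ∘ Fin.punchIn-cancel-≤ i d c)

punchIn-≤-suc : ∀ {k} i (c : Fin k) → punchIn i c Fin.≤ suc c
punchIn-≤-suc zero    c       = ℕ.≤-refl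
punchIn-≤-suc (suc i) zero    = z≤n
punchIn-≤-suc (suc i) (suc c) = s≤s (punchIn-≤-suc i c)

-- The first column, which splitting treats differently from the others; `drop 1` of a row is its
-- part in the other columns.
heads : ∀ {a} {A : Set a} → List (List A) → List A
heads []            = []
heads ([] ∷ T)      = heads T
heads ((h ∷ _) ∷ T) = h ∷ heads T

module _ {a} {A : Set a} where

  ∈-concat⇒heads∨tails : ∀ {i : A} T → i ∈ concat T → i ∈ heads T ⊎ Any (λ r → i ∈ drop 1 r) T
  ∈-concat⇒heads∨tails ([] ∷ T) i∈ with ∈-concat⇒heads∨tails T i∈
  ... | inj₁ i∈h = inj₁ i∈h
  ... | inj₂ i∈t = inj₂ (there i∈t)
  ∈-concat⇒heads∨tails ((h ∷ r) ∷ T) (here i≡h) = inj₁ (here i≡h)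
  ∈-concat⇒heads∨tails ((h ∷ r) ∷ T) (there i∈) with ∈-++⁻ r i∈
  ... | inj₁ i∈r = inj₂ (here i∈r)
  ... | inj₂ i∈T with ∈-concat⇒heads∨tails T i∈T
  ...   | inj₁ i∈h = inj₁ (there i∈h)
  ...   | inj₂ i∈t = inj₂ (there i∈t)

  all-tails : ∀ {p} {P : A → Set p} {T i} → All (All P ∘ drop 1) T → Any (λ r → i ∈ drop 1 r) T → P i
  all-tails (pr ∷ _)  (here i∈)  = All.lookup pr i∈
  all-tails (_ ∷ pT)  (there i∈) = all-tails pT i∈

module _ {k : ℕ} where

  pointwise-above : ∀ {y : Fin k} {xs ys : List (Fin k)} →
    All (y Fin.≤_) xs → Pointwise Fin._<_ xs ys → All (y Fin.<_) ys
  pointwise-above []          []            = []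
  pointwise-above (y≤x ∷ y≤)  (x<y ∷ xs<ys) = ℕ.≤-<-trans y≤x x<y ∷ pointwise-above y≤ xs<ys

  -- Column strictness turns a weak bound on one row, right of the first column, into a strict bound
  -- on the next, and so on all rows below.
  tails-above : ∀ {y : Fin k} {r : List (Fin k)} {T : Tableau k} →
    All (y Fin.≤_) (drop 1 r) → Linked _Above_ (r ∷ T) →
    All (All (y Fin.<_) ∘ drop 1) T
  tails-above y≤ [-] = []
  tails-above {r = []}    y≤ (_∷_ {y = []}    ab l) = [] ∷ tails-above {r = []} [] l
  tails-above {r = _ ∷ _} y≤ (_∷_ {y = []}    ab l) = [] ∷ tails-above {r = []} [] l
  tails-above {r = _ ∷ t} y≤ (_∷_ {y = _ ∷ t′} (_ ∷ ab) l) = y< ∷ tails-above {r = _ ∷ t′} (All.map ℕ.<⇒≤ y<) l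
    where y< = pointwise-above (All.take⁺ (length t′) y≤) ab

  heads-∉⇒All-≢ : ∀ {y : Fin k} T → y ∉ heads T → All (All (y Fin.<_) ∘ drop 1) T → All (All (_≢ y)) T
  heads-∉⇒All-≢ []            y∉ []        = []
  heads-∉⇒All-≢ ([] ∷ T)      y∉ (_ ∷ y<)  = [] ∷ heads-∉⇒All-≢ T y∉ y<
  heads-∉⇒All-≢ ((h ∷ r) ∷ T) y∉ (y<r ∷ y<) =
    ((λ { refl → y∉ (here refl) }) ∷ All.map (λ y<c → λ { refl → ℕ.<-irrefl refl y<c }) y<r) ∷
    heads-∉⇒All-≢ T (y∉ ∘ there) y<

  module _ {l : ℕ} (f : Fin k → Fin l) {Q : Fin k → Set}
           (f-mono : ∀ {c d} → c Fin.< d → Q d → f c Fin.< f d) where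

    map-above : ∀ t t′ → All Q t′ → t Above t′ → map f t Above map f t′
    map-above t       []        []       ab         = []
    map-above (c ∷ t) (d ∷ t′) (q ∷ qs) (c<d ∷ ab) = f-mono c<d q ∷ map-above t t′ qs ab

-- The side condition `Q` is asked only of elements with a predecessor: it will say that a row
-- avoids the letter being merged, and the first row contains that letter.
linked-map : ∀ {a b ℓ ℓ′ q} {A : Set a} {B : Set b} {R : A → A → Set ℓ} {S : B → B → Set ℓ′}
  {Q : A → Set q} {f : A → B} → (∀ {x y} → R x y → Q y → S (f x) (f y)) →
  ∀ {x xs} → Linked R (x ∷ xs) → All Q xs → Linked S (map f (x ∷ xs))
linked-map g [-]     []       = [-]
linked-map g (r ∷ l) (q ∷ qs) = g r q ∷ linked-map g l qs

-- With y the second entry of the first row, columns other than the first only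
-- contain letters ≥ y, so the letters below y stand alone in the first column.
Pivoted : ∀ {k} → Tableau k → Set
Pivoted T@((z ∷ y ∷ r) ∷ rs) = y ∈ heads T
Pivoted _                    = ⊥

pivoted? : ∀ {k} → Decidable (Pivoted {k})
pivoted? []                 = no id
pivoted? ([] ∷ _)           = no id
pivoted? ((_ ∷ []) ∷ _)     = no id
pivoted? T@((z ∷ y ∷ r) ∷ rs) = y ∈? heads T

-- In the first column letters up to `y` stay and larger ones move up. In the other columns every
-- letter is at least `y` and moves up, which frees `y` there.
splitRow : ∀ {k} → Fin k → List (Fin k) → List (Fin (suc k))
splitRow y []      = []
splitRow y (h ∷ t) = punchIn (suc y) h ∷ map suc t

-- split separates the y of the first column from the other occurrences of y,
-- which become y + 1; merge undoes this.  Other tableaux are sent to junk.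
split : ∀ {k} → Tableau k → Tableau (suc k)
split T@((z ∷ y ∷ r) ∷ rs) = map (splitRow y) T
split _                    = []

merge : ∀ {k} → Tableau (suc k) → Tableau k
merge T@((z ∷ suc p ∷ r) ∷ rs) = map (map (pinch p)) T
merge _                        = []

splitRow-above : ∀ {k} (y : Fin k) r r′ → r Above r′ → splitRow y r Above splitRow y r′
splitRow-above y r       []        ab         = []
splitRow-above y (h ∷ t) (h′ ∷ t′) (h< ∷ ab) = punchIn-mono-< (suc y) h< ∷
  map-above suc {Q = λ _ → ⊤} (λ c<d _ → s≤s c<d) t t′ (All.universal (λ _ → tt) t′) ab

splitRow-linked : ∀ {k} (y : Fin k) {r} → Linked Fin._≤_ r → Linked Fin._≤_ (splitRow y r)
splitRow-linked y []             = []
splitRow-linked y [-]            = [-]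
splitRow-linked y (_∷_ {x = h} h≤c l) =
  ℕ.≤-trans (punchIn-≤-suc (suc y) h) (s≤s h≤c) ∷ Linked.map⁺ (Linked.map s≤s l)

length-splitRow : ∀ {k} (y : Fin k) r → length (splitRow y r) ≡ length r
length-splitRow y []      = refl
length-splitRow y (h ∷ t) = cong suc (List.length-map suc t)

heads-splitRow : ∀ {k} (y : Fin k) T → heads (map (splitRow y) T) ≡ map (punchIn (suc y)) (heads T)
heads-splitRow y []            = refl
heads-splitRow y ([] ∷ T)      = heads-splitRow y T
heads-splitRow y ((h ∷ _) ∷ T) = cong (punchIn (suc y) h ∷_) (heads-splitRow y T)

heads-map : ∀ {a b} {A : Set a} {B : Set b} (f : A → B) T → heads (map (map f) T) ≡ map f (heads T)
heads-map f []            = refl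
heads-map f ([] ∷ T)      = heads-map f T
heads-map f ((h ∷ _) ∷ T) = cong (f h ∷_) (heads-map f T)

heads⇒∈-split : ∀ {k} (y : Fin k) {i} T → i ∈ heads T → punchIn (suc y) i ∈ concat (map (splitRow y) T)
heads⇒∈-split y ([] ∷ T)      i∈          = heads⇒∈-split y T i∈
heads⇒∈-split y ((h ∷ t) ∷ T) (here refl) = here refl
heads⇒∈-split y ((h ∷ t) ∷ T) (there i∈)  = ∈-++⁺ʳ (splitRow y (h ∷ t)) (heads⇒∈-split y T i∈)

tails⇒∈-split : ∀ {k} (y : Fin k) {i} T → Any (λ r → i ∈ drop 1 r) T → suc i ∈ concat (map (splitRow y) T)
tails⇒∈-split y ((h ∷ t) ∷ T) (here i∈)  = there (∈-++⁺ˡ (∈-map⁺ suc i∈))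
tails⇒∈-split y (r ∷ T)       (there i∈) = ∈-++⁺ʳ (splitRow y r) (tails⇒∈-split y T i∈)

punchIn-suc-< : ∀ {k} {y i : Fin k} → y Fin.< i → punchIn (suc y) i ≡ suc i
punchIn-suc-< {y = zero}  {suc i} y<i       = refl
punchIn-suc-< {y = suc y} {suc i} (s≤s y<i) = cong suc (punchIn-suc-< y<i)

module _ (k a : ℕ) (λs : List ℕ) where

  private
    μ : List ℕ
    μ = suc (suc a) ∷ λs

  tails≥pivot : ∀ {k} {z y : Fin k} {r rs} → Semistandard ((z ∷ y ∷ r) ∷ rs) →
    All (y Fin.≤_) (y ∷ r) × All (All (y Fin.<_) ∘ drop 1) rs
  tails≥pivot {y = y} {r = r} (((_ ∷ row) ∷ _) , cols) = y≤ , tails-above {r = _ ∷ y ∷ r} y≤ cols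
    where
    y≤ : All (y Fin.≤_) (y ∷ r)
    y≤ = Linked.Linked⇒All ℕ.≤-trans ℕ.≤-refl row

  -- Pivotedness matters for the letter `y` alone: its copies right of the first column become
  -- `suc y`, so the copy in the first column has to supply `y`.
  split-packed : ∀ {T} → IsPackedTableau k μ T → Pivoted T → IsPackedTableau (suc k) μ (split T)
  split-packed {T@((z ∷ y ∷ r) ∷ rs)} (isPackedTableau shape ss@(rows , cols) packed) pivoted =
    isPackedTableau
      (trans (sym (List.map-∘ T)) (trans (List.map-cong (length-splitRow y) T) shape))
      (All.map⁺ (All.map (splitRow-linked y) rows) ,
       Linked.map⁺ (Linked.map (λ {r} {r′} → splitRow-above y r r′) cols))
      letter
    where
    letter : ∀ i → i ∈ concat (split T)
    letter i with i Fin.≟ suc y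
    ... | yes refl = there (here refl)
    ... | no  i≢   = subst (_∈ concat (split T)) (Fin.punchIn-punchOut (i≢ ∘ sym)) (old (punchOut (i≢ ∘ sym)))
      where
      old : ∀ j → punchIn (suc y) j ∈ concat (split T)
      old j with j Fin.≟ y | ∈-concat⇒heads∨tails T (packed j)
      ... | yes refl | _        = heads⇒∈-split y T pivoted
      ... | no _     | inj₁ j∈h = heads⇒∈-split y T j∈h
      ... | no j≢y   | inj₂ j∈t = subst (_∈ concat (split T)) (sym (punchIn-suc-< y<j)) (tails⇒∈-split y T j∈t)
        where
        y≤j : y Fin.≤ j
        y≤j = let y≤ , y< = tails≥pivot ss in all-tails (y≤ ∷ All.map (All.map ℕ.<⇒≤) y<) j∈t
        y<j : y Fin.< j
        y<j = Fin.≤∧≢⇒< y≤j (j≢y ∘ sym)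

  -- The new first column lies in the image of `punchIn (suc y)`, which omits the new second entry
  -- `suc y` of the first row.
  split-¬pivoted : ∀ {T} → IsPackedTableau k μ T → ¬ Pivoted (split T)
  split-¬pivoted {T@((z ∷ y ∷ r) ∷ rs)} _ pivoted
    with ∈-map⁻ (punchIn (suc y)) (subst (suc y ∈_) (heads-splitRow y T) pivoted)
  ... | h , _ , e = Fin.punchInᵢ≢i (suc y) h (sym e)

  merge-split : ∀ {T} → IsPackedTableau k μ T → merge (split T) ≡ T
  merge-split {T@((z ∷ y ∷ r) ∷ rs)} (isPackedTableau _ ss _) = let y≤ , y< = tails≥pivot ss in
    trans (sym (List.map-∘ T)) (trans (List.map-cong-local
      (All.map (λ {r} → row {r}) (y≤ ∷ All.map (All.map ℕ.<⇒≤) y<))) (List.map-id T))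
    where
    row : ∀ {r} → All (y Fin.≤_) (drop 1 r) → map (pinch y) (splitRow y r) ≡ r
    row {[]}    _  = refl
    row {h ∷ t} y≤ = cong₂ _∷_ (pinch-punchIn y h)
      (trans (sym (List.map-∘ t)) (trans (List.map-cong-local (All.map pinch-suc y≤)) (List.map-id t)))

  -- The first row increases weakly, so it starts with `zero` as well. Hence an unpivoted tableau
  -- always has a preceding letter to merge with.
  zero-pivoted : ∀ {z : Fin (suc k)} {r rs} → Semistandard ((z ∷ zero ∷ r) ∷ rs) → Pivoted ((z ∷ zero ∷ r) ∷ rs)
  zero-pivoted {zero}  _ = here refl
  zero-pivoted {suc z} (((() ∷ _) ∷ _) , _)

  -- Columns stay strict because `suc p` does not occur below the first row: not in the first
  -- column, the tableau being unpivoted, and not in the others, whose entries there exceed it.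
  merge-packed : ∀ {T} → IsPackedTableau (suc k) μ T → ¬ Pivoted T → IsPackedTableau k μ (merge T)
  merge-packed {(z ∷ zero ∷ r) ∷ rs}    (isPackedTableau _ ss _) ¬piv = contradiction (zero-pivoted ss) ¬piv
  merge-packed {T@((z ∷ suc p ∷ r) ∷ rs)} (isPackedTableau shape ss@(rows , cols) packed) ¬piv =
    isPackedTableau
      (trans (sym (List.map-∘ T)) (trans (List.map-cong (List.length-map (pinch p)) T) shape))
      (All.map⁺ (All.map (λ row → Linked.map⁺ (Linked.map (λ {c} {d} → Fin.pinch-mono-≤ p {c} {d}) row)) rows) ,
       linked-map (λ {t} {t′} ab q → map-above (pinch p) (pinch-mono-< p) t t′ q ab) cols
         (heads-∉⇒All-≢ rs (¬piv ∘ there) (proj₂ (tails≥pivot ss))))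
      (λ i → subst (i ∈_) (sym (List.concat-map T))
         (subst (_∈ map (pinch p) (concat T)) (pinch-punchIn p i) (∈-map⁺ (pinch p) (packed (punchIn (suc p) i)))))

  -- Packedness provides a letter `p`. Being smaller than `suc p`, it must stand in the first
  -- column, and after merging it equals the second entry of the first row.
  merge-pivoted : ∀ {T} → IsPackedTableau (suc k) μ T → ¬ Pivoted T → Pivoted (merge T)
  merge-pivoted {(z ∷ zero ∷ r) ∷ rs}    (isPackedTableau _ ss _) ¬piv = contradiction (zero-pivoted ss) ¬piv
  merge-pivoted {T@((z ∷ suc p ∷ r) ∷ rs)} (isPackedTableau _ ss packed) ¬piv
    with ∈-concat⇒heads∨tails T (packed (inject₁ p))
  ... | inj₁ p∈h = subst₂ _∈_ (trans (pinch-inject₁ p) (sym (pinch-suc ℕ.≤-refl)))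
    (sym (heads-map (pinch p) T)) (∈-map⁺ (pinch p) p∈h)
  ... | inj₂ p∈t = contradiction
    (let y≤ , y< = tails≥pivot ss in all-tails (y≤ ∷ All.map (All.map ℕ.<⇒≤) y<) p∈t)
    (λ le → ℕ.1+n≰n (ℕ.≤-trans le (ℕ.≤-reflexive (Fin.toℕ-inject₁ p))))

  split-merge : ∀ {T} → IsPackedTableau (suc k) μ T → ¬ Pivoted T → split (merge T) ≡ T
  split-merge {(z ∷ zero ∷ r) ∷ rs}    (isPackedTableau _ ss _) ¬piv = contradiction (zero-pivoted ss) ¬piv
  split-merge {T@((z ∷ suc p ∷ r) ∷ rs)} (isPackedTableau _ ss _) ¬piv = let y≤ , y< = tails≥pivot ss in
    trans (cong (λ y → map (splitRow y) (merge T)) (pinch-suc ℕ.≤-refl))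
      (trans (sym (List.map-∘ T)) (trans (List.map-cong-local
        (row (¬piv ∘ here ∘ sym) y≤ ∷ rest rs (¬piv ∘ there) y<)) (List.map-id T)))
    where
    row : ∀ {h t} → h ≢ suc p → All (suc p Fin.≤_) t → splitRow p (map (pinch p) (h ∷ t)) ≡ h ∷ t
    row {h} {t} h≢ y≤ = cong₂ _∷_ (punchIn-pinch p h h≢)
      (trans (sym (List.map-∘ t)) (trans (List.map-cong-local (All.map suc-pinch y≤)) (List.map-id t)))
    rest : ∀ rs → suc p ∉ heads rs → All (All (suc p Fin.<_) ∘ drop 1) rs →
      All (λ r → splitRow p (map (pinch p) r) ≡ r) rs
    rest []            y∉ []        = []
    rest ([] ∷ rs)     y∉ (_ ∷ y<)  = refl ∷ rest rs y∉ y<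
    rest ((h ∷ t) ∷ rs) y∉ (y<t ∷ y<) =
      row (λ { refl → y∉ (here refl) }) (All.map ℕ.<⇒≤ y<t) ∷ rest rs (y∉ ∘ there) y<

-- Numbers of packed tableaux

length-filter-¬ : ∀ {a p} {A : Set a} {P : Pred A p} (P? : Decidable P) xs →
  length xs ≡ length (filter P? xs) + length (filter (¬? ∘ P?) xs)
length-filter-¬ P? []       = refl
length-filter-¬ P? (x ∷ xs) with P? x
... | yes _ = cong suc (length-filter-¬ P? xs)
... | no _  = trans (cong suc (length-filter-¬ P? xs)) (sym (ℕ.+-suc _ _))

packedTableaux-unique : ∀ k λs → Unique (packedTableaux k λs)
packedTableaux-unique k λs = Unique.filter⁺ (λ T → semistandard? T ×-dec packed? T) (fillings-unique k λs)

#packed : ℕ → List ℕ → ℕ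
#packed k λs = length (packedTableaux k λs)

∉⇒length≡0 : ∀ {a} {A : Set a} (xs : List A) → (∀ {x} → x ∉ xs) → length xs ≡ 0
∉⇒length≡0 []       none = refl
∉⇒length≡0 (x ∷ xs) none = contradiction (here refl) none

module _ (a : ℕ) (λs : List ℕ) where

  private
    μ : List ℕ
    μ = suc (suc a) ∷ λs

  pivotedTableaux unpivotedTableaux : ∀ k → List (Tableau k)
  pivotedTableaux   k = filter pivoted? (packedTableaux k μ)
  unpivotedTableaux k = filter (¬? ∘ pivoted?) (packedTableaux k μ)

  pivoted-split : ∀ k → length (pivotedTableaux k) ≡ length (unpivotedTableaux (suc k))
  pivoted-split k = ℕ.≤-antisym
    (retract⇒length-≤ (Unique.filter⁺ pivoted? (packedTableaux-unique k μ)) split merge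
      (λ T∈ → let T∈′ , piv = ∈-filter⁻ pivoted? {xs = packedTableaux k μ} T∈
                  isT = ∈-packedTableaux⁻ k μ T∈′ in
        ∈-filter⁺ (¬? ∘ pivoted?) (∈-packedTableaux⁺ (split-packed k a λs isT piv)) (split-¬pivoted k a λs isT))
      (λ T∈ → merge-split k a λs (∈-packedTableaux⁻ k μ (proj₁ (∈-filter⁻ pivoted? {xs = packedTableaux k μ} T∈)))))
    (retract⇒length-≤ (Unique.filter⁺ (¬? ∘ pivoted?) (packedTableaux-unique (suc k) μ)) merge split
      (λ T∈ → let T∈′ , ¬piv = ∈-filter⁻ (¬? ∘ pivoted?) {xs = packedTableaux (suc k) μ} T∈
                  isT = ∈-packedTableaux⁻ (suc k) μ T∈′ in
        ∈-filter⁺ pivoted? (∈-packedTableaux⁺ (merge-packed k a λs isT ¬piv)) (merge-pivoted k a λs isT ¬piv))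
      (λ T∈ → let T∈′ , ¬piv = ∈-filter⁻ (¬? ∘ pivoted?) {xs = packedTableaux (suc k) μ} T∈ in
        split-merge k a λs (∈-packedTableaux⁻ (suc k) μ T∈′) ¬piv))

  -- No letter is available for the first cell, so there is no unpivoted tableau. The form is that
  -- of the base case of a telescoping sum.
  #packed-zero : #packed 0 μ ≡ length (pivotedTableaux 0)
  #packed-zero = trans (length-filter-¬ pivoted? (packedTableaux 0 μ))
    (trans (cong (length (pivotedTableaux 0) +_) (∉⇒length≡0 _ none)) (ℕ.+-identityʳ _))
    where
    none : ∀ {T} → T ∉ unpivotedTableaux 0
    none {T} T∈ with ∈-packedTableaux⁻ 0 μ (proj₁ (∈-filter⁻ (¬? ∘ pivoted?) {xs = packedTableaux 0 μ} T∈))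
    none {[]} _ | isPackedTableau () _ _
    none {[] ∷ _} _ | isPackedTableau () _ _
    none {(() ∷ _) ∷ _} _ | _

  -- The unpivoted tableaux on `suc k` letters are the split pivoted ones on `k` letters, so
  -- consecutive terms of the alternating sum share a summand.
  #packed-suc : ∀ k → #packed (suc k) μ ≡ length (pivotedTableaux (suc k)) + length (pivotedTableaux k)
  #packed-suc k = trans (length-filter-¬ pivoted? (packedTableaux (suc k) μ))
    (cong (length (pivotedTableaux (suc k)) +_) (sym (pivoted-split k)))

  -- Splitting a letter would give a packed tableau with more letters than cells.
  pivoted-top : length (pivotedTableaux (sum μ)) ≡ 0
  pivoted-top = trans (pivoted-split (sum μ)) (∉⇒length≡0 _ λ T∈ → contradiction
    (packed-letters-≤ (∈-packedTableaux⁻ (suc (sum μ)) μ (proj₁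
      (∈-filter⁻ (¬? ∘ pivoted?) {xs = packedTableaux (suc (sum μ)) μ} T∈))))
    ℕ.1+n≰n)

sum-ones : ∀ n → sum (replicate n 1) ≡ n
sum-ones zero    = refl
sum-ones (suc n) = cong suc (sum-ones n)

column-linked : ∀ {k} n (T : Tableau k) → map length T ≡ replicate n 1 →
  Linked _Above_ T → Linked Fin._<_ (concat T)
column-linked n       []                            _  _                = []
column-linked (suc n) ((c ∷ []) ∷ [])               _  _                = [-]
column-linked (suc n) ((c ∷ []) ∷ T@((d ∷ []) ∷ _)) sh ((c<d ∷ []) ∷ l) =
  c<d ∷ column-linked n T (List.∷-injectiveʳ sh) l
column-linked (suc zero) ((c ∷ []) ∷ [] ∷ T) () _
column-linked (suc (suc n)) ((c ∷ []) ∷ [] ∷ T) () _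
column-linked (suc zero) ((c ∷ []) ∷ (_ ∷ _ ∷ _) ∷ T) () _
column-linked (suc (suc n)) ((c ∷ []) ∷ (_ ∷ _ ∷ _) ∷ T) () _
column-linked zero    (_ ∷ _)           () _
column-linked (suc n) ([] ∷ _)          () _
column-linked (suc n) ((_ ∷ _ ∷ _) ∷ _) () _

#packed-column-< : ∀ {k n} → k < n → #packed k (replicate n 1) ≡ 0
#packed-column-< {k} {n} k<n = ∉⇒length≡0 _ λ {T} T∈ →
  let isPackedTableau sh (_ , cols) _ = ∈-packedTableaux⁻ k (replicate n 1) T∈ in
  contradiction
    (subst₂ _≤_ (trans (length-concat T) (trans (cong sum sh) (sum-ones n)))
            (List.length-tabulate {n = k} id)
      (unique-⊆-length (allFin k)
        (AllPairs.map Fin.<⇒≢ (Linked.Linked⇒AllPairs ℕ.<-trans (column-linked n T sh cols)))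
        (λ {i} _ → ∈-allFin i)))
    (ℕ.<⇒≱ k<n)

-- The witness is the column filled with all letters in order. A lower bound is enough, as only
-- positivity of the functional at the column enters.
#packed-column-≡ : ∀ n → 1 ≤ #packed n (replicate n 1)
#packed-column-≡ n = ∈-length (∈-packedTableaux⁺ {T = map (_∷ []) (allFin n)} (isPackedTableau
    (trans (ones (allFin n)) (cong (λ m → replicate m 1) (List.length-tabulate {n = n} id)))
    (All.map⁺ (All.universal (λ _ → [-]) (allFin n)) ,
     Linked.map⁺ (Linked.map (λ c<d → c<d ∷ []) (Linked.AllPairs⇒Linked (AllPairs.tabulate⁺-< id))))
    (λ i → subst (i ∈_) (sym (List.concat-map-[ allFin n ])) (∈-allFin i))))
  where
  ones : ∀ {A : Set} (xs : List A) → map length (map (_∷ []) xs) ≡ replicate (length xs) 1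
  ones []       = refl
  ones (x ∷ xs) = cong (1 ∷_) (ones xs)

-- Linear functionals on series

∈-compositions⁻ : ∀ n {λs} → λs ∈ compositions n → All (1 ≤_) λs × sum λs ≡ n
∈-compositions⁻ zero    (here refl) = [] , refl
∈-compositions⁻ (suc n) λs∈ with find (∈-concatMap⁻ grow {xs = compositions n} λs∈)
... | []     , as∈ , here refl         = s≤s z≤n ∷ [] , cong suc (proj₂ (∈-compositions⁻ n as∈))
... | a ∷ as , as∈ , here refl         = let pos , sum≡ = ∈-compositions⁻ n as∈ in s≤s z≤n ∷ pos , cong suc sum≡
... | a ∷ as , as∈ , there (here refl) with ∈-compositions⁻ n as∈
...   | _ ∷ pos , sum≡ = s≤s z≤n ∷ pos , cong suc sum≡

ones∈compositions : ∀ n → replicate n 1 ∈ compositions n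
ones∈compositions zero    = here refl
ones∈compositions (suc n) = ∈-concatMap⁺ grow (lose (ones∈compositions n) (∈-grow (replicate n 1)))
  where
  ∈-grow : ∀ as → 1 ∷ as ∈ grow as
  ∈-grow []       = here refl
  ∈-grow (a ∷ as) = here refl

ones∈partitions : ∀ n → replicate n 1 ∈ partitions n
ones∈partitions n = ∈-filter⁺ (linked? ℕ._≥?_) (ones∈compositions n) (linked n)
  where
  linked : ∀ n → Linked _≥_ (replicate n 1)
  linked zero          = []
  linked (suc zero)    = [-]
  linked (suc (suc n)) = ℕ.≤-refl ∷ linked (suc n)

partition-sum : ∀ n {λs} → λs ∈ partitions n → sum λs ≡ n
partition-sum n λs∈ = proj₂ (∈-compositions⁻ n (proj₁ (∈-filter⁻ (linked? ℕ._≥?_) {xs = compositions n} λs∈)))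

partition-cases : ∀ n {λs} → λs ∈ partitions n → λs ≡ replicate n 1 ⊎ ∃₂ λ a as → λs ≡ suc (suc a) ∷ as
partition-cases n λs∈ with ∈-filter⁻ (linked? ℕ._≥?_) {xs = compositions n} λs∈
... | λs∈′ , linked with ∈-compositions⁻ n λs∈′
partition-cases n {λs = []}                λs∈ | _ , linked | _          , refl = inj₁ refl
partition-cases n {λs = zero ∷ as}         λs∈ | _ , linked | () ∷ _     , _
partition-cases n {λs = suc (suc a) ∷ as}  λs∈ | _ , linked | _          , _ = inj₂ (a , as , refl)
partition-cases n {λs = suc zero ∷ as}     λs∈ | _ , linked | _ ∷ pos    , refl = inj₁ (cong (1 ∷_) (ones as linked pos))
  where
  ones : ∀ as → Linked _≥_ (1 ∷ as) → All (1 ≤_) as → as ≡ replicate (sum as) 1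
  ones []       _             _            = refl
  ones (a ∷ as) (1≥a ∷ linked) (1≤a ∷ pos) with ℕ.≤-antisym 1≥a 1≤a
  ... | refl = cong (1 ∷_) (ones as linked pos)

-- Sums of rationals

ι : ℕ → ℚ
ι m = ℤ.+ m / 1

ι-+ : ∀ m n → ι (m + n) ≡ ι m +ℚ ι n
ι-+ m n = ℚ.toℚᵘ-injective (begin
  toℚᵘ (ι (m + n))                ≈⟨ ℚ.toℚᵘ-fromℚᵘ (mkℚᵘ (ℤ.+ (m + n)) 0) ⟩
  mkℚᵘ (ℤ.+ (m + n)) 0              ≈⟨ *≡* (cong (λ z → (z ℤ.* ℤ.+ 1))
                                        (sym (cong₂ ℤ._+_ (ℤ.*-identityʳ (ℤ.+ m)) (ℤ.*-identityʳ (ℤ.+ n))))) ⟩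
  mkℚᵘ (ℤ.+ m) 0 ℚᵘ.+ mkℚᵘ (ℤ.+ n) 0    ≈⟨ ℚᵘ.+-cong (ℚ.toℚᵘ-fromℚᵘ (mkℚᵘ (ℤ.+ m) 0)) (ℚ.toℚᵘ-fromℚᵘ (mkℚᵘ (ℤ.+ n) 0)) ⟨
  toℚᵘ (ι m) ℚᵘ.+ toℚᵘ (ι n)        ≈⟨ ℚ.toℚᵘ-homo-+ (ι m) (ι n) ⟨
  toℚᵘ (ι m +ℚ ι n)                  ∎)
  where open ℚᵘ.≃-Reasoning

0≤ι : ∀ m → 0ℚ ≤ℚ ι m
0≤ι m = ℚ.nonNegative⁻¹ (ι m) {{ℚ.normalize-nonNeg m 1}}

0<ι : ∀ {m} → 1 ≤ m → 0ℚ <ℚ ι m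
0<ι {suc m} _ = ℚ.positive⁻¹ (ι (suc m)) {{ℚ.normalize-pos (suc m) 1}}

module _ {a} {A : Set a} where

  ∑ℚ : List A → (A → ℚ) → ℚ
  ∑ℚ xs f = foldr _+ℚ_ 0ℚ (map f xs)

  ∑ℚ-cong-∈ : ∀ xs {f g} → (∀ {x} → x ∈ xs → f x ≡ g x) → ∑ℚ xs f ≡ ∑ℚ xs g
  ∑ℚ-cong-∈ []       f≗g = refl
  ∑ℚ-cong-∈ (x ∷ xs) f≗g = cong₂ _+ℚ_ (f≗g (here refl)) (∑ℚ-cong-∈ xs (f≗g ∘ there))

  ∑ℚ-ι : ∀ xs (f : A → ℕ) → ∑ℚ xs (ι ∘ f) ≡ ι (∑ℕ xs f)
  ∑ℚ-ι []       f = refl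
  ∑ℚ-ι (x ∷ xs) f = trans (cong (_+ℚ_ (ι (f x))) (∑ℚ-ι xs f)) (sym (ι-+ (f x) (∑ℕ xs f)))

  ∑ℚ-zero : ∀ xs → ∑ℚ xs (λ _ → 0ℚ) ≡ 0ℚ
  ∑ℚ-zero []       = refl
  ∑ℚ-zero (x ∷ xs) = trans (ℚ.+-identityˡ _) (∑ℚ-zero xs)

  ∑ℚ-+ : ∀ xs f g → ∑ℚ xs (λ x → f x +ℚ g x) ≡ ∑ℚ xs f +ℚ ∑ℚ xs g
  ∑ℚ-+ []       f g = refl
  ∑ℚ-+ (x ∷ xs) f g = trans (cong (_+ℚ_ (f x +ℚ g x)) (∑ℚ-+ xs f g)) (ℚ-interchange (f x) (g x) _ _)

  ∑ℚ-*ˡ : ∀ c xs f → ∑ℚ xs (λ x → c *ℚ f x) ≡ c *ℚ ∑ℚ xs f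
  ∑ℚ-*ˡ c []       f = sym (ℚ.*-zeroʳ c)
  ∑ℚ-*ˡ c (x ∷ xs) f = trans (cong (_+ℚ_ (c *ℚ f x)) (∑ℚ-*ˡ c xs f)) (sym (ℚ.*-distribˡ-+ c (f x) _))

  ∑ℚ-mono : ∀ xs {f g} → (∀ {x} → x ∈ xs → f x ≤ℚ g x) → ∑ℚ xs f ≤ℚ ∑ℚ xs g
  ∑ℚ-mono []       f≤g = ℚ.≤-refl
  ∑ℚ-mono (x ∷ xs) f≤g = ℚ.+-mono-≤ (f≤g (here refl)) (∑ℚ-mono xs (f≤g ∘ there))

  ∑ℚ-nonNeg : ∀ xs {f} → (∀ {x} → x ∈ xs → 0ℚ ≤ℚ f x) → 0ℚ ≤ℚ ∑ℚ xs f
  ∑ℚ-nonNeg xs 0≤f = ℚ.≤-trans (ℚ.≤-reflexive (sym (∑ℚ-zero xs))) (∑ℚ-mono xs 0≤f)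

  ∑ℚ-pos : ∀ xs {f} → (∀ {x} → x ∈ xs → 0ℚ ≤ℚ f x) → ∀ {x} → x ∈ xs → 0ℚ <ℚ f x → 0ℚ <ℚ ∑ℚ xs f
  ∑ℚ-pos (x ∷ xs) 0≤f (here refl) 0<fx = ℚ.+-mono-<-≤ 0<fx (∑ℚ-nonNeg xs (0≤f ∘ there))
  ∑ℚ-pos (x ∷ xs) 0≤f (there x∈)  0<fx = ℚ.+-mono-≤-< (0≤f (here refl)) (∑ℚ-pos xs (0≤f ∘ there) x∈ 0<fx)

  -- A strict inequality in a single term would make the sums differ.
  ∑ℚ-≤-≡ : ∀ xs {f g} → (∀ x → f x ≤ℚ g x) → ∑ℚ xs f ≡ ∑ℚ xs g → ∀ {x} → x ∈ xs → f x ≡ g x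
  ∑ℚ-≤-≡ (x ∷ xs) {f} {g} f≤g ∑≡ = λ where
      (here refl) → fx≡gx
      (there x∈)  → ∑ℚ-≤-≡ xs f≤g (ℚ-+-cancelˡ (f x) _ _ (trans ∑≡ (cong (_+ℚ ∑ℚ xs g) (sym fx≡gx)))) x∈
    where
    fx≡gx : f x ≡ g x
    fx≡gx = ℚ.≤-antisym (f≤g x)
      (ℚ.≮⇒≥ (λ fx<gx → ℚ.<-irrefl ∑≡ (ℚ.+-mono-<-≤ fx<gx (∑ℚ-mono xs (λ {y} _ → f≤g y)))))

record IsLinear (Φ : Series → ℚ) : Set where
  field
    ≈-cong  : ∀ {F H} → F ≈ H → Φ F ≡ Φ H
    +-homo  : ∀ F H → Φ (λ α → F α +ℚ H α) ≡ Φ F +ℚ Φ H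
    ·-homo  : ∀ q F → Φ (q · F) ≡ q *ℚ Φ F

  0-homo : Φ (λ _ → 0ℚ) ≡ 0ℚ
  0-homo = trans (·-homo 0ℚ (λ _ → 0ℚ)) (ℚ.*-zeroˡ (Φ (λ _ → 0ℚ)))

  ∑-homo : ∀ {a} {A : Set a} (xs : List A) (c : A → ℚ) (F : A → Series) →
    Φ (∑ xs (λ x → c x · F x)) ≡ ∑ℚ xs (λ x → c x *ℚ Φ (F x))
  ∑-homo []       c F = 0-homo
  ∑-homo (x ∷ xs) c F = trans (+-homo (c x · F x) _) (cong₂ _+ℚ_ (·-homo (c x) (F x)) (∑-homo xs c F))

open IsLinear

-- Box sums and the column functional

boxSum : List ℕ → ℕ → Series → ℚ
boxSum ps k F = ∑ℚ (box ps k) (F ∘ Vec.toList)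

boxSum-linear : ∀ ps k → IsLinear (boxSum ps k)
boxSum-linear ps k .≈-cong F≈H    = ∑ℚ-cong-∈ (box ps k) (λ {v} _ → F≈H (Vec.toList v))
boxSum-linear ps k .+-homo F H    = ∑ℚ-+ (box ps k) (F ∘ Vec.toList) (H ∘ Vec.toList)
boxSum-linear ps k .·-homo q F    = ∑ℚ-*ˡ q (box ps k) (F ∘ Vec.toList)

-- The sign is normalized at the top term `f n`, which is the term that survives for the column.
alternating : ℕ → (ℕ → ℚ) → ℚ
alternating zero    f = f zero
alternating (suc n) f = f (suc n) -ℚ alternating n f

alternating-cong : ∀ n {f g} → (∀ k → f k ≡ g k) → alternating n f ≡ alternating n g
alternating-cong zero    f≗g = f≗g zero
alternating-cong (suc n) f≗g = cong₂ _-ℚ_ (f≗g (suc n)) (alternating-cong n f≗g)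

alternating-linear : ∀ n {Φ : ℕ → Series → ℚ} → (∀ k → IsLinear (Φ k)) →
  IsLinear (λ F → alternating n (λ k → Φ k F))
alternating-linear zero    lin = lin zero
alternating-linear (suc n) {Φ} lin = λ where
    .≈-cong F≈H → cong₂ _-ℚ_ (lin (suc n) .≈-cong F≈H) (rec .≈-cong F≈H)
    .+-homo F H → begin
      Φ (suc n) (λ α → F α +ℚ H α) -ℚ Ψ (λ α → F α +ℚ H α)
        ≡⟨ cong₂ _-ℚ_ (lin (suc n) .+-homo F H) (rec .+-homo F H) ⟩
      (Φ (suc n) F +ℚ Φ (suc n) H) -ℚ (Ψ F +ℚ Ψ H)
        ≡⟨ cong (_+ℚ_ (Φ (suc n) F +ℚ Φ (suc n) H)) (ℚ.neg-distrib-+ (Ψ F) (Ψ H)) ⟩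
      (Φ (suc n) F +ℚ Φ (suc n) H) +ℚ (ℚ.- Ψ F +ℚ ℚ.- Ψ H)
        ≡⟨ ℚ-interchange (Φ (suc n) F) (Φ (suc n) H) (ℚ.- Ψ F) (ℚ.- Ψ H) ⟩
      (Φ (suc n) F -ℚ Ψ F) +ℚ (Φ (suc n) H -ℚ Ψ H) ∎
    .·-homo q F → begin
      Φ (suc n) (q · F) -ℚ Ψ (q · F)  ≡⟨ cong₂ _-ℚ_ (lin (suc n) .·-homo q F) (rec .·-homo q F) ⟩
      q *ℚ Φ (suc n) F -ℚ q *ℚ Ψ F      ≡⟨ cong (_+ℚ_ (q *ℚ Φ (suc n) F)) (ℚ.neg-distribʳ-* q (Ψ F)) ⟩
      q *ℚ Φ (suc n) F +ℚ q *ℚ ℚ.- Ψ F    ≡⟨ ℚ.*-distribˡ-+ q (Φ (suc n) F) (ℚ.- Ψ F) ⟨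
      q *ℚ (Φ (suc n) F -ℚ Ψ F)        ∎
  where
  open ≡-Reasoning
  Ψ : Series → ℚ
  Ψ F = alternating n (λ k → Φ k F)
  rec : IsLinear Ψ
  rec = alternating-linear n lin

alternating-telescope : ∀ n {f A : ℕ → ℕ} → f 0 ≡ A 0 → (∀ k → f (suc k) ≡ A (suc k) + A k) →
  alternating n (ι ∘ f) ≡ ι (A n)
alternating-telescope zero    {f} {A} f0 fs = cong ι f0
alternating-telescope (suc n) {f} {A} f0 fs = begin
  ι (f (suc n)) -ℚ alternating n (ι ∘ f)  ≡⟨ cong₂ _-ℚ_ (trans (cong ι (fs n)) (ι-+ (A (suc n)) (A n)))
                                              (alternating-telescope n {f} {A} f0 fs) ⟩
  (ι (A (suc n)) +ℚ ι (A n)) -ℚ ι (A n)    ≡⟨ ℚ.+-assoc (ι (A (suc n))) (ι (A n)) (ℚ.- ι (A n)) ⟩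
  ι (A (suc n)) +ℚ (ι (A n) -ℚ ι (A n))    ≡⟨ cong (_+ℚ_ (ι (A (suc n)))) (ℚ.+-inverseʳ (ι (A n))) ⟩
  ι (A (suc n)) +ℚ 0ℚ                     ≡⟨ ℚ.+-identityʳ (ι (A (suc n))) ⟩
  ι (A (suc n))                          ∎
  where open ≡-Reasoning

alternating-zero : ∀ n {f} → (∀ {k} → k ≤ n → f k ≡ 0ℚ) → alternating n f ≡ 0ℚ
alternating-zero zero    f≡0 = f≡0 z≤n
alternating-zero (suc n) f≡0 = cong₂ _-ℚ_ (f≡0 ℕ.≤-refl) (alternating-zero n (f≡0 ∘ ℕ.m≤n⇒m≤1+n))

alternating-top : ∀ n {f} → (∀ {k} → k < n → f k ≡ 0ℚ) → alternating n f ≡ f n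
alternating-top zero        f≡0 = refl
alternating-top (suc n) {f} f≡0 =
  trans (cong (_-ℚ_ (f (suc n))) (alternating-zero n (f≡0 ∘ s≤s))) (ℚ.+-identityʳ (f (suc n)))

-- The nonzero exponents possible in degree `n`. Requiring them makes all `k` variables occur, so
-- that `k` is the number of parts of a composition.
parts : ℕ → List ℕ
parts n = map suc (upTo n)

parts-unique : ∀ n → Unique (parts n)
parts-unique n = Unique.map⁺ ℕ.suc-injective (Unique.upTo⁺ n)

module _ {k n : ℕ} (w : List (Fin k)) (len : length w ≡ n) where

  occ∈parts⇒∈ : ∀ i → occ w i ∈ parts n → i ∈ w
  occ∈parts⇒∈ i occ∈ with ∈-map⁻ suc occ∈
  ... | m , _ , occ≡ = ∈-occ w i (subst (1 ≤_) (sym occ≡) (s≤s z≤n))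

  ∈⇒occ∈parts : ∀ i → i ∈ w → occ w i ∈ parts n
  ∈⇒occ∈parts i i∈w with occ w i | occ-∈ w i i∈w | occ-≤ w i
  ... | suc m | _ | m<len = ∈-map⁺ suc (∈-upTo⁺ (subst (m <_) len m<len))

boxSum-X : ∀ {n} (G : Graph n) {ps} → Unique ps → ∀ k → boxSum ps k (X G) ≡
  ι (length (filter (λ κ → properColoring? G κ ×-dec Fin.all? λ i → occ (Vec.toList κ) i ∈ℕ? ps) (words k n)))
boxSum-X {n} G {ps} u k = begin
  ∑ℚ (box ps k) (X G ∘ Vec.toList)
    ≡⟨ ∑ℚ-cong-∈ (box ps k) (λ {v} _ → cong ι (at-toList
         (λ l f → withOcc (properColoring? G) Vec.toList (words l n) f)
         (λ {l} → withOcc-cong (properColoring? G) Vec.toList (words l n)) v)) ⟩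
  ∑ℚ (box ps k) (λ v → ι (withOcc (properColoring? G) Vec.toList (words k n) (Vec.lookup v)))
    ≡⟨ ∑ℚ-ι (box ps k) _ ⟩
  ι (∑ℕ (box ps k) (λ v → withOcc (properColoring? G) Vec.toList (words k n) (Vec.lookup v)))
    ≡⟨ cong ι (∑-box-withOcc (properColoring? G) Vec.toList u (words k n)) ⟩
  _ ∎
  where
  open ≡-Reasoning


boxSum-s : ∀ λs k → boxSum (parts (sum λs)) k (s λs) ≡ ι (#packed k λs)
boxSum-s λs k = begin
  ∑ℚ (box ps k) (s λs ∘ Vec.toList)
    ≡⟨ ∑ℚ-cong-∈ (box ps k) (λ {v} _ → cong ι (at-toList
         (λ l f → withOcc semistandard? concat (fillings l λs) f)
         (λ {l} → withOcc-cong semistandard? concat (fillings l λs)) v)) ⟩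
  ∑ℚ (box ps k) (λ v → ι (withOcc semistandard? concat (fillings k λs) (Vec.lookup v)))
    ≡⟨ ∑ℚ-ι (box ps k) _ ⟩
  ι (∑ℕ (box ps k) (λ v → withOcc semistandard? concat (fillings k λs) (Vec.lookup v)))
    ≡⟨ cong ι (trans (∑-box-withOcc semistandard? concat (parts-unique (sum λs)) (fillings k λs)) contents≡) ⟩
  ι (#packed k λs) ∎
  where
  open ≡-Reasoning

  ps : List ℕ
  ps = parts (sum λs)
  contents≡ : length (filter (λ T → semistandard? T ×-dec Fin.all? λ i → occ (concat T) i ∈ℕ? ps)
                             (fillings k λs)) ≡ #packed k λs
  contents≡ = trans (length-filter-∑ _ (fillings k λs)) (trans
    (∑ℕ-cong-∈ (fillings k λs) λ {T} T∈ →
      let len = trans (length-concat T) (cong sum (∈-fillings⁻ λs T∈)) in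
      𝟙-cong (semistandard? T ×-dec Fin.all? λ i → occ (concat T) i ∈ℕ? ps) (semistandard? T ×-dec packed? T)
        (λ (ss , h) → ss , λ i → occ∈parts⇒∈ (concat T) len i (h i))
        (λ (ss , h) → ss , λ i → ∈⇒occ∈parts (concat T) len i (h i)))
    (sym (length-filter-∑ (λ T → semistandard? T ×-dec packed? T) (fillings k λs))))

-- On symmetric functions of degree n this is, up to a positive factor, the
-- coefficient of s_{1ⁿ}; up to sign it is the principal specialization at -1.
columnFunctional : ℕ → Series → ℚ
columnFunctional n F = alternating n (λ k → boxSum (parts n) k F)

columnFunctional-linear : ∀ n → IsLinear (columnFunctional n)
columnFunctional-linear n = alternating-linear n (boxSum-linear (parts n))

columnFunctional-s : ∀ λs → columnFunctional (sum λs) (s λs) ≡ alternating (sum λs) (λ k → ι (#packed k λs))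
columnFunctional-s λs = alternating-cong (sum λs) (boxSum-s λs)

columnFunctional-noncolumn : ∀ {n λs} a as → λs ≡ suc (suc a) ∷ as → sum λs ≡ n →
  columnFunctional n (s λs) ≡ 0ℚ
columnFunctional-noncolumn {n} {λs} a as refl refl = begin
  columnFunctional n (s λs)                  ≡⟨ columnFunctional-s λs ⟩
  alternating n (λ k → ι (#packed k λs))     ≡⟨ alternating-telescope n {λ k → #packed k λs} {length ∘ pivotedTableaux a as}
                                                  (#packed-zero a as) (#packed-suc a as) ⟩
  ι (length (pivotedTableaux a as n))        ≡⟨ cong ι (pivoted-top a as) ⟩
  0ℚ                                         ∎
  where open ≡-Reasoning

-- A strictly increasing column of `n` cells needs `n` letters, so only the term `k = n` is nonzero.
columnFunctional-column : ∀ n → 0ℚ <ℚ columnFunctional n (s (replicate n 1))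
columnFunctional-column n = subst (0ℚ <ℚ_) (sym (begin
  columnFunctional n (s col)                 ≡⟨ cong (λ m → columnFunctional m (s col)) (sum-ones n) ⟨
  columnFunctional (sum col) (s col)         ≡⟨ columnFunctional-s col ⟩
  alternating (sum col) (λ k → ι (#packed k col)) ≡⟨ cong (λ m → alternating m (λ k → ι (#packed k col))) (sum-ones n) ⟩
  alternating n (λ k → ι (#packed k col))    ≡⟨ alternating-top n (cong ι ∘ #packed-column-<) ⟩
  ι (#packed n col)                          ∎)) (0<ι (#packed-column-≡ n))
  where
  open ≡-Reasoning
  col : List ℕ
  col = replicate n 1

-- The value of the functional at the column, counted as often as the column is listed in
-- `partitions n`. Summing over the whole list absorbs that multiplicity, and the other shapes
-- contribute zero.
columnWeight : ℕ → ℚ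
columnWeight n = ∑ℚ (partitions n) (λ λs → columnFunctional n (s λs))

partition-functional : ∀ n {λs} → λs ∈ partitions n → λs ≡ replicate n 1 ⊎ columnFunctional n (s λs) ≡ 0ℚ
partition-functional n {λs} λs∈ = Sum.map₂ noncolumn (partition-cases n λs∈)
  where
  noncolumn : (∃₂ λ a as → λs ≡ suc (suc a) ∷ as) → columnFunctional n (s λs) ≡ 0ℚ
  noncolumn (a , as , λs≡) = columnFunctional-noncolumn a as λs≡ (partition-sum n λs∈)

columnWeight-pos : ∀ n → 0ℚ <ℚ columnWeight n
columnWeight-pos n = ∑ℚ-pos (partitions n) {λ λs → columnFunctional n (s λs)} nonNeg
  (ones∈partitions n) (columnFunctional-column n)
  where
  nonNeg : ∀ {λs} → λs ∈ partitions n → 0ℚ ≤ℚ columnFunctional n (s λs)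
  nonNeg {λs} λs∈ =
    Sum.[ (λ col → subst (λ μ → 0ℚ ≤ℚ columnFunctional n (s μ)) (sym col)
                         (ℚ.<⇒≤ (columnFunctional-column n)))
        , (λ eq → ℚ.≤-reflexive (sym eq)) ] (partition-functional n λs∈)

-- Every coefficient may be replaced by that of the column, since the terms of the other shapes
-- vanish anyway; it then factors out.
columnFunctional-coefficient : ∀ {n F} (E : SchurExpansion n F) →
  columnFunctional n F ≡ [s replicate n 1 ] E *ℚ columnWeight n
columnFunctional-coefficient {n} {F} E = begin
  columnFunctional n F
    ≡⟨ columnFunctional-linear n .≈-cong expands ⟩
  columnFunctional n (∑ (partitions n) (λ λs → coeff λs · s λs))
    ≡⟨ ∑-homo (columnFunctional-linear n) (partitions n) coeff s ⟩
  ∑ℚ (partitions n) (λ λs → coeff λs *ℚ columnFunctional n (s λs))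
    ≡⟨ ∑ℚ-cong-∈ (partitions n) onlyColumn ⟩
  ∑ℚ (partitions n) (λ λs → coeff (replicate n 1) *ℚ columnFunctional n (s λs))
    ≡⟨ ∑ℚ-*ˡ (coeff (replicate n 1)) (partitions n) (λ λs → columnFunctional n (s λs)) ⟩
  coeff (replicate n 1) *ℚ columnWeight n ∎
  where
  open ≡-Reasoning
  open SchurExpansion E
  onlyColumn : ∀ {λs} → λs ∈ partitions n →
    coeff λs *ℚ columnFunctional n (s λs) ≡ coeff (replicate n 1) *ℚ columnFunctional n (s λs)
  onlyColumn {λs} λs∈ = Sum.[ cong (λ μ → coeff μ *ℚ columnFunctional n (s λs))
                            , (λ eq → trans (vanishes (coeff λs) eq) (sym (vanishes (coeff (replicate n 1)) eq))) ]
                            (partition-functional n λs∈)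
    where
    vanishes : ∀ c → columnFunctional n (s λs) ≡ 0ℚ → c *ℚ columnFunctional n (s λs) ≡ 0ℚ
    vanishes c eq = trans (cong (c *ℚ_) eq) (ℚ.*-zeroʳ c)

-- Comparing two trees

-- Occurrence numbers in `parts n` mean that all `k` colors are used, so the weight is the indicator
-- of `d ≡ k`.
tree-boxSum-parts : ∀ {n} (G H : Graph n) → IsTree G → IsTree H → ∀ k →
  boxSum (parts n) k (X G) ≡ boxSum (parts n) k (X H)
tree-boxSum-parts {n} G H treeG treeH k = trans (boxSum-X G (parts-unique n) k) (trans
  (cong ι (tree-colorings G H treeG treeH used? (λ d → 𝟙 (d ℕ.≟ k)) λ κ →
    let w = Vec.toList κ ; len = Vec.length-toList κ in
    𝟙-cong (used? κ) (distinct w ℕ.≟ k)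
      (λ h → ∈⇒distinct≡k w (λ i → occ∈parts⇒∈ w len i (h i)))
      (λ d≡k i → ∈⇒occ∈parts w len i (distinct≡k⇒∈ w d≡k i))))
  (sym (boxSum-X H (parts-unique n) k)))
  where
  used? : (κ : Vec (Fin k) n) → Dec (∀ i → occ (Vec.toList κ) i ∈ parts n)
  used? κ = Fin.all? λ i → occ (Vec.toList κ) i ∈ℕ? parts n

-- No color is used more than `n` times, so the box catches every proper coloring and the weight is
-- constant: the chromatic polynomials agree at `k`.
tree-boxSum-upTo : ∀ {n} (G H : Graph n) → IsTree G → IsTree H → ∀ {m} → n < m → ∀ k →
  boxSum (upTo m) k (X G) ≡ boxSum (upTo m) k (X H)
tree-boxSum-upTo {n} G H treeG treeH {m} n<m k = trans (boxSum-X G (Unique.upTo⁺ m) k) (trans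
  (cong ι (tree-colorings G H treeG treeH bounded? (λ _ → 1) λ κ → 𝟙-yes (bounded? κ) λ i →
    ∈-upTo⁺ (ℕ.≤-<-trans (subst (occ (Vec.toList κ) i ≤_) (Vec.length-toList κ) (occ-≤ (Vec.toList κ) i)) n<m)))
  (sym (boxSum-X H (Unique.upTo⁺ m) k)))
  where
  bounded? : (κ : Vec (Fin k) n) → Dec (∀ i → occ (Vec.toList κ) i ∈ upTo m)
  bounded? κ = Fin.all? λ i → occ (Vec.toList κ) i ∈ℕ? upTo m

tree-columnCoefficient : ∀ {n} (G H : Graph n) → IsTree G → IsTree H →
  (E : SchurExpansion n (X G)) (E′ : SchurExpansion n (X H)) → [s replicate n 1 ] E ≡ [s replicate n 1 ] E′
tree-columnCoefficient {n} G H treeG treeH E E′ = ℚ.≤-antisym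
  (ℚ.*-cancelʳ-≤-pos (columnWeight n) (ℚ.≤-reflexive same))
  (ℚ.*-cancelʳ-≤-pos (columnWeight n) (ℚ.≤-reflexive (sym same)))
  where
  instance
    pos : Positive (columnWeight n)
    pos = positive (columnWeight-pos n)
  same : [s replicate n 1 ] E *ℚ columnWeight n ≡ [s replicate n 1 ] E′ *ℚ columnWeight n
  same = trans (sym (columnFunctional-coefficient E))
    (trans (alternating-cong n (tree-boxSum-parts G H treeG treeH)) (columnFunctional-coefficient E′))

schurPositive⇒nonNeg : ∀ {n F} → SchurPositive n F → ∀ α → 0ℚ ≤ℚ F α
schurPositive⇒nonNeg {n} {F} (E , nonNeg) α = subst (0ℚ ≤ℚ_) (sym (expands α))
  (∑ℚ-nonNeg (partitions n) λ {λs} λs∈ → ℚ.nonNegative⁻¹ (coeff λs *ℚ s λs α)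
    {{ℚ.nonNeg*nonNeg⇒nonNeg (coeff λs) {{nonNegative (All.lookup nonNeg λs∈)}}
                             (s λs α) {{nonNegative (0≤s λs)}}}})
  where
  open SchurExpansion E
  0≤s : ∀ λs → 0ℚ ≤ℚ s λs α
  0≤s λs = 0≤ι (length (filter (λ T → semistandard? T ×-dec hasContent? α (concat T))
                               (fillings (length α) λs)))

boxSum-≤-≡ : ∀ ps {k F H} → (∀ α → F α ≤ℚ H α) → boxSum ps k F ≡ boxSum ps k H →
  ∀ {v} → v ∈ box ps k → F (Vec.toList v) ≡ H (Vec.toList v)
boxSum-≤-≡ ps {k} F≤H = ∑ℚ-≤-≡ (box ps k) (F≤H ∘ Vec.toList)

∈-box-fromList : ∀ {ps α} → All (_∈ ps) α → Vec.fromList α ∈ box ps (length α)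
∈-box-fromList []        = here refl
∈-box-fromList (a∈ ∷ α⊆) = ∈-cartesianProductWith⁺ Vec._∷_ a∈ (∈-box-fromList α⊆)

parts-≤-sum : ∀ α → All (_≤ sum α) α
parts-≤-sum []      = []
parts-≤-sum (a ∷ α) = ℕ.m≤m+n a (sum α) ∷ All.map (λ b≤ → ℕ.≤-trans b≤ (ℕ.m≤n+m (sum α) a)) (parts-≤-sum α)

≤∧boxSum≡⇒≈ : ∀ n {F H : Series} → (∀ α → F α ≤ℚ H α) →
  (∀ {m} → n < m → ∀ k → boxSum (upTo m) k F ≡ boxSum (upTo m) k H) → F ≈ H
≤∧boxSum≡⇒≈ n {F} {H} F≤H sums≡ α = subst (λ β → F β ≡ H β) (Vec.toList∘fromList α)
  (boxSum-≤-≡ (upTo m) F≤H (sums≡ (s≤s (ℕ.m≤m+n n (sum α))) (length α)) v∈box)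
  where
  m : ℕ
  -- Large enough both for the hypothesis `n < m` and for every entry of `α` to lie in `upTo m`.
  m = suc (n + sum α)
  v∈box : Vec.fromList α ∈ box (upTo m) (length α)
  v∈box = ∈-box-fromList (All.map (λ a≤ → ∈-upTo⁺ (s≤s (ℕ.≤-trans a≤ (ℕ.m≤n+m (sum α) n)))) (parts-≤-sum α))

tree-≤⇒≈ : ∀ {n} (G H : Graph n) → IsTree G → IsTree H → (∀ α → X G α ≤ℚ X H α) → X G ≈ X H
tree-≤⇒≈ {n} G H treeG treeH G≤H =
  ≤∧boxSum≡⇒≈ n {X G} {X H} G≤H (λ n<m → tree-boxSum-upTo G H treeG treeH n<m)

1-ratio-⊖ : ∀ {F H : Series} {r} → r ≡ 1ℚ → (∀ α → 0ℚ ≤ℚ (F ⊖ r · H) α) → ∀ α → H α ≤ℚ F α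
1-ratio-⊖ {F} {H} refl 0≤ α = begin
  H α                       ≡⟨ ℚ.+-identityˡ (H α) ⟨
  0ℚ +ℚ H α                  ≤⟨ ℚ.+-monoˡ-≤ (H α) (0≤ α) ⟩
  (F α -ℚ 1ℚ *ℚ H α) +ℚ H α    ≡⟨ cong (λ x → (F α -ℚ x) +ℚ H α) (ℚ.*-identityˡ (H α)) ⟩
  (F α -ℚ H α) +ℚ H α         ≡⟨ ℚ.+-assoc (F α) (ℚ.- H α) (H α) ⟩
  F α +ℚ (ℚ.- H α +ℚ H α)       ≡⟨ cong (_+ℚ_ (F α)) (ℚ.+-inverseˡ (H α)) ⟩
  F α +ℚ 0ℚ                  ≡⟨ ℚ.+-identityʳ (F α) ⟩
  F α                       ∎
  where open ℚ.≤-Reasoning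

÷-≡1 : ∀ {c d} .{{_ : NonZero d}} → c ≡ d → c ÷ d ≡ 1ℚ
÷-≡1 {d = d} refl = ℚ.*-inverseʳ d

tree-≥ₛ⇒≈ : ∀ {n} (T₁ T₂ : 𝒮 n) → IsTree (graph T₁) → IsTree (graph T₂) → T₁ ≥ₛ T₂ →
  X (graph T₂) ≈ X (graph T₁)
tree-≥ₛ⇒≈ {n} T₁ T₂ tree₁ tree₂ (E , E′ , nz , positive) =
  tree-≤⇒≈ (graph T₂) (graph T₁) tree₂ tree₁
    (1-ratio-⊖ {X (graph T₁)} {X (graph T₂)}
      (÷-≡1 {{nz}} (tree-columnCoefficient (graph T₁) (graph T₂) tree₁ tree₂ E E′))
      (schurPositive⇒nonNeg positive))

corollary4p7 : (n : ℕ) (T₁ T₂ : 𝒮 n) → IsTree (graph T₁) → IsTree (graph T₂) →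
    ¬ (X (graph T₁) ≈ X (graph T₂)) →
    ¬ (T₁ ≥ₛ T₂) × ¬ (T₂ ≥ₛ T₁)
corollary4p7 n T₁ T₂ tree₁ tree₂ X₁≉X₂ =
  (λ T₁≥T₂ → X₁≉X₂ (λ α → sym (tree-≥ₛ⇒≈ T₁ T₂ tree₁ tree₂ T₁≥T₂ α))) ,
  (λ T₂≥T₁ → X₁≉X₂ (tree-≥ₛ⇒≈ T₂ T₁ tree₂ tree₁ T₂≥T₁))
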